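{- Let $G$ be a connected graph. Then: (i) $G$ is a $2$-cactus if and only if each block of $G$ is either an edge, a cycle, or a $\theta_3$-graph. (ii) $G$ is a $3$-cactus if and only if each block of $G$ is either an edge, a cycle, or a $\theta_t$-graph with $3\le t\le 4$. (iii) $G$ is a $4$-cactus if and only if each block of $G$ is either an edge, a cycle, a $\theta_3'$-graph, or a $\theta_t$-graph with $3\le t\le 5$.
   Context: All graphs are finite and simple. For an integer $k\ge 1$, a $k$-cactus is a connected graph in which every edge is contained in at most $k$ cycles. A block of a graph is a maximal connected subgraph without a cut-vertex. For $t\ge 3$, the graph $\theta(l_1,\dots,l_t)$ is the union of $t$ internally vertex-disjoint paths of lengths $l_1,\dots,l_t$ (each $\ge 1$, at most one equal to $1$) having the same two end-vertices; a $\theta_t$-graph is any graph of the form $\theta(l_1,\dots,l_t)$. For a subgraph $F$ of a graph $H$, an ear of $F$ (in $H$) is a path in $H$ of length at least $1$ whose two (distinct) end-vertices lie in $F$ and whose internal vertices and edges do not lie in $F$. A $\theta_3'$-graph is a graph $\theta(p,q,r)\cup Q$, where $Q$ is an ear of $\theta(p,q,r)$ whose two end-vertices are not both the two degree-$3$ vertices of $\theta(p,q,r)$.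
   Formalization: The graph G is assumed to have at least two vertices: the one-vertex graph is vacuously a k-cactus, but its only block is a single vertex, which is neither an edge, a cycle, a θ_t-graph nor a θ₃′-graph. -}

module Defs where

open import Data.Nat using (ℕ; suc; _≤_; _<_)
open import Data.Fin using (Fin; _≟_)
open import Data.Bool using (Bool; true; false; T; not; _∧_)
open import Data.List using (List; []; _∷_; _++_; length)
open import Data.List.Relation.Unary.All using (All)
open import Data.List.Relation.Unary.Unique.Propositional using (Unique)
open import Data.List.Membership.Propositional using (_∈_)
open import Data.Product using (Σ; ∃; ∃-syntax; _×_; _,_)
open import Data.Sum using (_⊎_)
import Data.Empty
import Data.Product
open import Relation.Nullary using (¬_; does)
open import Relation.Binary.PropositionalEquality using (_≡_; _≢_)
open import Function.Bundles using (_⇔_)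

record Graph : Set where
  field
    n      : ℕ
    adj    : Fin n → Fin n → Bool
    sym    : ∀ u v → adj u v ≡ adj v u
    irrefl : ∀ v → adj v v ≡ false

pairs : ∀ {A : Set} → List A → List (A × A)
pairs []           = []
pairs (x ∷ [])     = []
pairs (x ∷ y ∷ xs) = (x , y) ∷ pairs (y ∷ xs)

cpairs : ∀ {A : Set} → List A → List (A × A)
cpairs []       = []
cpairs (x ∷ xs) = pairs (x ∷ xs ++ x ∷ [])

EdgeIn : ∀ {A : Set} → List (A × A) → A → A → Set
EdgeIn ps u w = ((u , w) ∈ ps) ⊎ ((w , u) ∈ ps)

module _ (G : Graph) where
  open Graph G

  Adj : Fin n → Fin n → Set
  Adj u v = T (adj u v)

  data Reach (E : Fin n → Fin n → Bool) : Fin n → Fin n → Set where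
    here : ∀ {u} → Reach E u u
    step : ∀ {u w v} → T (E u w) → Reach E w v → Reach E u v

  ConnectedVE : (Fin n → Bool) → (Fin n → Fin n → Bool) → Set
  ConnectedVE V E = ∀ u v → T (V u) → T (V v) → Reach E u v

  Connected : Set
  Connected = ConnectedVE (λ _ → true) adj

  record Subgraph : Set where
    field
      V      : Fin n → Bool
      E      : Fin n → Fin n → Bool
      E-sym  : ∀ u v → E u v ≡ E v u
      E⊆adj  : ∀ u v → T (E u v) → Adj u v
      E-ends : ∀ u v → T (E u v) → T (V u)

  open Subgraph public

  _⊆_ : Subgraph → Subgraph → Set
  H ⊆ H' = (∀ v → T (V H v) → T (V H' v))
         × (∀ u v → T (E H u v) → T (E H' u v))

  SubConnected : Subgraph → Set
  SubConnected H = ConnectedVE (V H) (E H)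

  delV : (Fin n → Bool) → Fin n → Fin n → Bool
  delV V x v = V v ∧ not (does (v ≟ x))

  delE : (Fin n → Fin n → Bool) → Fin n → Fin n → Fin n → Bool
  delE E x u v = E u v ∧ not (does (u ≟ x)) ∧ not (does (v ≟ x))

  CutVertex : Subgraph → Fin n → Set
  CutVertex H x = T (V H x) × ¬ ConnectedVE (delV (V H) x) (delE (E H) x)

  IsBlock : Subgraph → Set
  IsBlock H = SubConnected H
            × (∀ x → ¬ CutVertex H x)
            × (∀ H' → H ⊆ H' → SubConnected H' → (∀ x → ¬ CutVertex H' x) → H' ⊆ H)

  record Cycle : Set where
    field
      cverts : List (Fin n)
      clen   : 3 ≤ length cverts
      cuniq  : Unique cverts
      cadj   : All (λ p → Adj (Data.Product.proj₁ p) (Data.Product.proj₂ p)) (cpairs cverts)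

  open Cycle public

  CycEdge : Cycle → Fin n → Fin n → Set
  CycEdge C = EdgeIn (cpairs (cverts C))

  -- two cycles are the same subgraph iff they have the same edge set
  SameCycle : Cycle → Cycle → Set
  SameCycle C D = ∀ u w → CycEdge C u w ⇔ CycEdge D u w

  -- k-cactus: connected, every edge lies in at most k (distinct) cycles,
  -- i.e. among any k+1 cycles through the edge, two coincide.
  KCactus : ℕ → Set
  KCactus k = Connected
            × (∀ u w → Adj u w → (cs : Fin (suc k) → Cycle)
               → (∀ i → CycEdge (cs i) u w)
               → ∃[ i ] ∃[ j ] (i ≢ j × SameCycle (cs i) (cs j)))

  pathList : Fin n → List (Fin n) → Fin n → List (Fin n)
  pathList x mid y = x ∷ mid ++ y ∷ []

  IsPath : Fin n → List (Fin n) → Fin n → Set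
  IsPath x mid y = Unique (pathList x mid y)
                 × All (λ p → Adj (Data.Product.proj₁ p) (Data.Product.proj₂ p))
                       (pairs (pathList x mid y))

  PathEdge : Fin n → List (Fin n) → Fin n → Fin n → Fin n → Set
  PathEdge x mid y = EdgeIn (pairs (pathList x mid y))

  record Theta (t : ℕ) : Set where
    field
      tx tys     : Fin n
      tx≢ty      : tx ≢ tys
      mids       : Fin t → List (Fin n)
      paths      : ∀ i → IsPath tx (mids i) tys
      disjoint   : ∀ i j → i ≢ j → ∀ v → v ∈ mids i → v ∈ mids j → Data.Empty.⊥
      atMostOne1 : ∀ i j → mids i ≡ [] → mids j ≡ [] → i ≡ j

  open Theta public

  ThetaV : ∀ {t} → Theta t → Fin n → Set
  ThetaV {t} θ v = v ≡ tx θ ⊎ v ≡ tys θ ⊎ ∃[ i ] (v ∈ mids θ i)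

  ThetaE : ∀ {t} → Theta t → Fin n → Fin n → Set
  ThetaE {t} θ u w = ∃[ i ] PathEdge (tx θ) (mids θ i) (tys θ) u w

  -- an ear Q = a, q1, ..., b of a θ-graph, whose ends are not both
  -- the two degree-3 vertices
  record Ear {t : ℕ} (θ : Theta t) : Set where
    field
      ea eb   : Fin n
      ea≢eb   : ea ≢ eb
      eaIn    : ThetaV θ ea
      ebIn    : ThetaV θ eb
      emid    : List (Fin n)
      epath   : IsPath ea emid eb
      einner  : ∀ v → v ∈ emid → ¬ ThetaV θ v
      eedges  : ∀ u w → PathEdge ea emid eb u w → ¬ ThetaE θ u w
      notBoth : ¬ ((ea ≡ tx θ × eb ≡ tys θ) ⊎ (ea ≡ tys θ × eb ≡ tx θ))

  open Ear public

  IsEdgeGraph : Subgraph → Set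
  IsEdgeGraph H = ∃[ u ] ∃[ w ] (Adj u w
    × (∀ v → T (V H v) ⇔ (v ≡ u ⊎ v ≡ w))
    × (∀ a b → T (E H a b) ⇔ ((a ≡ u × b ≡ w) ⊎ (a ≡ w × b ≡ u))))

  IsCycleGraph : Subgraph → Set
  IsCycleGraph H = Σ Cycle λ C →
      (∀ v → T (V H v) ⇔ v ∈ cverts C)
    × (∀ a b → T (E H a b) ⇔ CycEdge C a b)

  IsThetaGraph : ℕ → Subgraph → Set
  IsThetaGraph t H = Σ (Theta t) λ θ →
      (∀ v → T (V H v) ⇔ ThetaV θ v)
    × (∀ a b → T (E H a b) ⇔ ThetaE θ a b)

  IsTheta3'Graph : Subgraph → Set
  IsTheta3'Graph H = Σ (Theta 3) λ θ → Σ (Ear θ) λ Q →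
      (∀ v → T (V H v) ⇔ (ThetaV θ v ⊎ v ∈ pathList (ea Q) (emid Q) (eb Q)))
    × (∀ a b → T (E H a b) ⇔ (ThetaE θ a b ⊎ PathEdge (ea Q) (emid Q) (eb Q) a b))

-- In a 2-connected graph B every two edges lie on a common
-- cycle: given a cycle C through e and a vertex v of C, an edge vv' starts an ear of C, and the ear together
-- with the arc of C containing e is a cycle through e and vv'; walk towards the second edge.  Hence if a proper
-- subgraph F of B has m cycles through e, then B has at least m + 1.  Ears turn an edge into a cycle, a cycle
-- into a θ₃, and a θ₃ into a θ₄ or a θ₃′.  Every edge of a θ_t lies on t − 1 cycles, and a θ₃′ has an edge on
-- four: two in the θ₃, and two in a second θ₃ one of whose arcs contains both that edge and the ear.  This
-- leaves no room beyond the listed blocks.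
--
-- Conversely the cycles through an edge all lie in one block.  The edge set of a cycle has even degree at every
-- vertex, so it is constant along paths with interior vertices of degree two.  A cycle of a θ_t through a given
-- arc is therefore determined by the unique other arc it uses, while the even edge sets of a θ₃′ form a space
-- of dimension three over the field with two elements, so that at most four of them contain a given edge.

{-# OPTIONS --safe #-}
module Submission where

open import Defs
open import Data.Bool using (Bool; true; false; T; not; _∨_; _xor_)
open import Data.Bool.Properties using (T-∨; xor-identityʳ; xor-comm; xor-same; not-involutive)
open import Data.Empty using (⊥; ⊥-elim)
open import Data.Fin as Fin using (Fin; zero; suc; _≟_; punchIn; punchOut; splitAt; inject≤; combine)
open import Data.Fin.Properties using (any?; all?; pigeonhole; injective⇒≤; inject≤-injective; suc-injective; <⇒≢)
open import Data.Fin.Properties using (punchInᵢ≢i; punchIn-injective; punchIn-punchOut; punchOut-injective)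
open import Data.Fin.Properties using (join-splitAt; combine-injective)
open import Data.List using (List; []; _∷_; _++_; length; lookup; map; allFin; cartesianProduct; initLast; _∷ʳ′_)
open import Data.List.Membership.Propositional using (_∈_; _∉_)
open import Data.List.Membership.Propositional.Properties using (∈-++⁺ˡ; ∈-++⁺ʳ; ∈-++⁻; ∈-∃++; ∈-lookup)
open import Data.List.Membership.Propositional.Properties using (∈-map⁺; ∈-allFin; ∈-cartesianProduct⁺)
open import Data.List.Properties using (++-assoc)
open import Data.List.Relation.Binary.Permutation.Propositional using (_↭_; ↭-sym; ↭-refl; ↭⇒↭ₛ)
open import Data.List.Relation.Binary.Permutation.Propositional.Properties using (++-comm; ∈-resp-↭; ↭-length)
import Data.List.Relation.Binary.Permutation.Setoid.Properties as PermSetoid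
open import Data.List.Relation.Unary.All as All using (All; []; _∷_)
open import Data.List.Relation.Unary.AllPairs using ([]; _∷_)
open import Data.List.Relation.Unary.Any using (here; there)
open import Data.List.Relation.Unary.Unique.Propositional using (Unique)
import Data.List.Relation.Unary.Unique.Propositional.Properties as Unique
open import Data.Nat using (ℕ; zero; suc; _+_; _≤_; z≤n; s≤s)
open import Data.Nat.Properties using (≤-refl; ≤-trans; n≤1+n)
open import Data.Product using (Σ; ∃; ∃-syntax; _×_; _,_; proj₁; proj₂)
open import Data.Product.Properties using (≡-dec)
open import Data.Sum as Sum using (_⊎_; inj₁; inj₂; [_,_]′)
open import Data.Unit using (⊤; tt)
open import Function using (_∘_; case_of_)
open import Function.Bundles using (_⇔_; mk⇔; Equivalence)
open import Function.Construct.Symmetry using (⇔-sym)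
open import Relation.Binary.PropositionalEquality using (_≡_; _≢_; refl; sym; trans; cong; cong₂; subst; setoid)
open import Relation.Nullary using (¬_; Dec; yes; no; does)
open import Relation.Nullary.Decidable using (decidable-stable; ¬¬-excluded-middle; map′; T?; ¬?; _×-dec_; _⊎-dec_; _→-dec_)

-- Blocks are defined by maximality, and the block around a given cycle is produced only under a
-- double negation. This suffices for the converse because the conclusion wanted there, that two of
-- finitely many cycles have the same edges, is decidable.
--
-- The second `θ₃` of an ear whose ends are not both branch vertices has two origins. If both ends
-- lie on one arc, that arc is rerouted through the ear. If they lie inside different arcs, one
-- branch vertex moves to an end of the ear. Such an ear on a `θ₄` cannot occur in a 4-cactus:
-- removing an arc other than two that hold the ends leaves a `θ₃` with an ear, which already fills
-- the block.
--
-- The bound `2 ≤ n` matters: in the one-vertex graph the block is a single vertex, which is none of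
-- the listed graphs.

module Paths where

  -- Paths with their concatenation and reversal, and rotations of cyclic lists

  private variable
    A : Set
    x y z w v : A
    k l m : List A

  ∈-resp : l ≡ m → v ∈ l → v ∈ m
  ∈-resp refl i = i

  edge-resp : {ps qs : List (A × A)} → ps ≡ qs → ∀ {u w} → EdgeIn ps u w → EdgeIn qs u w
  edge-resp refl e = e

  edge-sym : {ps : List (A × A)} → ∀ {u w} → EdgeIn ps u w → EdgeIn ps w u
  edge-sym (inj₁ i) = inj₂ i
  edge-sym (inj₂ i) = inj₁ i

  edge-++⁻ : (ps : List (A × A)) {qs : List (A × A)} → ∀ {u w} →
    EdgeIn (ps ++ qs) u w → EdgeIn ps u w ⊎ EdgeIn qs u w
  edge-++⁻ ps (inj₁ i) = [ inj₁ ∘ inj₁ , inj₂ ∘ inj₁ ]′ (∈-++⁻ ps i)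
  edge-++⁻ ps (inj₂ i) = [ inj₁ ∘ inj₂ , inj₂ ∘ inj₂ ]′ (∈-++⁻ ps i)

  edge-++⁺ˡ : {ps qs : List (A × A)} → ∀ {u w} → EdgeIn ps u w → EdgeIn (ps ++ qs) u w
  edge-++⁺ˡ (inj₁ i) = inj₁ (∈-++⁺ˡ i)
  edge-++⁺ˡ (inj₂ i) = inj₂ (∈-++⁺ˡ i)

  edge-++⁺ʳ : (ps : List (A × A)) {qs : List (A × A)} → ∀ {u w} →
    EdgeIn qs u w → EdgeIn (ps ++ qs) u w
  edge-++⁺ʳ ps (inj₁ i) = inj₁ (∈-++⁺ʳ ps i)
  edge-++⁺ʳ ps (inj₂ i) = inj₂ (∈-++⁺ʳ ps i)

  edge-swap : (ps : List (A × A)) {qs : List (A × A)} → ∀ {u w} →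
    EdgeIn (ps ++ qs) u w → EdgeIn (qs ++ ps) u w
  edge-swap ps {qs} e = [ edge-++⁺ʳ qs , edge-++⁺ˡ ]′ (edge-++⁻ ps e)

  edge-∷⁻ : ∀ {a b u w : A} {ps} → EdgeIn ((a , b) ∷ ps) u w →
    ((u ≡ a × w ≡ b) ⊎ (u ≡ b × w ≡ a)) ⊎ EdgeIn ps u w
  edge-∷⁻ (inj₁ (here refl)) = inj₁ (inj₁ (refl , refl))
  edge-∷⁻ (inj₁ (there i))   = inj₂ (inj₁ i)
  edge-∷⁻ (inj₂ (here refl)) = inj₁ (inj₂ (refl , refl))
  edge-∷⁻ (inj₂ (there i))   = inj₂ (inj₂ i)

  edge-there : ∀ {p} {u w : A} {ps} → EdgeIn ps u w → EdgeIn (p ∷ ps) u w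
  edge-there (inj₁ i) = inj₁ (there i)
  edge-there (inj₂ i) = inj₂ (there i)

  pairs-++ : (l : List A) (z : A) (m : List A) →
    pairs (l ++ z ∷ m) ≡ pairs (l ++ z ∷ []) ++ pairs (z ∷ m)
  pairs-++ []          z m = refl
  pairs-++ (x ∷ [])    z m = refl
  pairs-++ (x ∷ y ∷ l) z m = cong ((x , y) ∷_) (pairs-++ (y ∷ l) z m)

  pairs-∈ : (l : List A) → ∀ {u w} → (u , w) ∈ pairs l → u ∈ l × w ∈ l
  pairs-∈ (x ∷ y ∷ l) (here refl) = here refl , there (here refl)
  pairs-∈ (x ∷ y ∷ l) (there i)   =
    let a , b = pairs-∈ (y ∷ l) i in there a , there b

  edge-∈ : (l : List A) → ∀ {u w} → EdgeIn (pairs l) u w → u ∈ l × w ∈ l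
  edge-∈ l (inj₁ i) = pairs-∈ l i
  edge-∈ l (inj₂ i) = let a , b = pairs-∈ l i in b , a

  ∉-of-unique : Unique (x ∷ l) → x ∉ l
  ∉-of-unique (px ∷ _) i = All.lookup px i refl

  ∷-unique : x ∉ l → Unique l → Unique (x ∷ l)
  ∷-unique x∉l ul = All.tabulate (λ i eq → x∉l (subst (_∈ _) (sym eq) i)) ∷ ul

  unique-tail : Unique (x ∷ l) → Unique l
  unique-tail (_ ∷ u) = u

  pairs-≢ : Unique l → ∀ {u w} → (u , w) ∈ pairs l → u ≢ w
  pairs-≢ {l = _ ∷ _ ∷ _} ul       (here refl) refl = ∉-of-unique ul (here refl)
  pairs-≢ {l = _ ∷ _ ∷ _} (_ ∷ ul) (there i)   = pairs-≢ ul i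

  edge-≢ : Unique l → ∀ {u w} → EdgeIn (pairs l) u w → u ≢ w
  edge-≢ ul (inj₁ i) = pairs-≢ ul i
  edge-≢ ul (inj₂ i) = pairs-≢ ul i ∘ sym

  -- The end vertices are indices, so the vertex shared by two consecutive trails is fixed by the
  -- types, and the list is nonempty by construction.
  data Trail {A : Set} : A → List A → A → Set where
    stop : Trail x (x ∷ []) x
    go   : Trail w l y → Trail x (x ∷ l) y

  pairs-trail : Trail w l y → pairs (x ∷ l) ≡ (x , w) ∷ pairs l
  pairs-trail stop   = refl
  pairs-trail (go _) = refl

  start∈ : Trail x l y → x ∈ l
  start∈ stop   = here refl
  start∈ (go _) = here refl

  end∈ : Trail x l y → y ∈ l
  end∈ stop   = here refl
  end∈ (go t) = there (end∈ t)

  -- Recursion on the trail drops the last vertex of `l` without inspecting the list: at `stop` it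
  -- is already the head of a trail `m` that starts at `z`.
  glue : {x z : A} {l : List A} → Trail x l z → List A → List A
  glue stop               m = m
  glue {x = x} (go t) m = x ∷ glue t m

  glue-trail : (t : Trail x l z) → Trail z m y → Trail x (glue t m) y
  glue-trail stop   s = s
  glue-trail (go t) s = go (glue-trail t s)

  pairs-glue : (t : Trail x l z) → Trail z m y → pairs (glue t m) ≡ pairs l ++ pairs m
  pairs-glue stop s = refl
  pairs-glue {x = x} {m = m} (go t) s
    rewrite pairs-trail {x = x} (glue-trail t s) | pairs-trail {x = x} t
    = cong (_ ∷_) (pairs-glue t s)

  ∈-glue⁻ : (t : Trail x l z) → v ∈ glue t m → v ∈ l ⊎ v ∈ m
  ∈-glue⁻ stop   i           = inj₂ i
  ∈-glue⁻ (go t) (here eq)   = inj₁ (here eq)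
  ∈-glue⁻ (go t) (there i)   = [ inj₁ ∘ there , inj₂ ]′ (∈-glue⁻ t i)

  ∈-glue⁺ˡ : (t : Trail x l z) → Trail z m y → v ∈ l → v ∈ glue t m
  ∈-glue⁺ˡ stop   s (here refl) = start∈ s
  ∈-glue⁺ˡ (go t) s (here eq)   = here eq
  ∈-glue⁺ˡ (go t) s (there i)   = there (∈-glue⁺ˡ t s i)

  ∈-glue⁺ʳ : (t : Trail x l z) → v ∈ m → v ∈ glue t m
  ∈-glue⁺ʳ stop   i = i
  ∈-glue⁺ʳ (go t) i = there (∈-glue⁺ʳ t i)

  glue-unique : (t : Trail x l z) → Unique l → Unique m →
    (∀ {v} → v ∈ l → v ∈ m → v ≡ z) → Unique (glue t m)
  glue-unique stop   ul um d = um
  glue-unique (go t) ul um d = ∷-unique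
    (λ i → [ ∉-of-unique ul
           , (λ j → ∉-of-unique ul (subst (_∈ _) (sym (d (here refl) j)) (end∈ t))) ]′ (∈-glue⁻ t i))
    (glue-unique t (unique-tail ul) um (λ i → d (there i)))

  record Path {A : Set} (x y : A) : Set where
    constructor path
    field
      {verts} : List A
      trail   : Trail x verts y
      simple  : Unique verts

  open Path

  infix 4 _∈ᵖ_
  _∈ᵖ_ : {x y : A} → A → Path x y → Set
  v ∈ᵖ p = v ∈ verts p

  Edge : {x y : A} → Path x y → A → A → Set
  Edge p = EdgeIn (pairs (verts p))

  edge-ends : (p : Path x y) → ∀ {u w} → Edge p u w → u ∈ᵖ p × w ∈ᵖ p
  edge-ends p = edge-∈ (verts p)

  -- One interface for a concatenation, whether it comes from gluing (`join`) or from cutting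
  -- (`split`).
  record Join {A : Set} {x z y : A} (p : Path x z) (q : Path z y) (r : Path x y) : Set where
    field
      ∈⁻    : v ∈ᵖ r → v ∈ᵖ p ⊎ v ∈ᵖ q
      ∈ˡ    : v ∈ᵖ p → v ∈ᵖ r
      ∈ʳ    : v ∈ᵖ q → v ∈ᵖ r
      edge⁻ : ∀ {u w} → Edge r u w → Edge p u w ⊎ Edge q u w
      edgeˡ : ∀ {u w} → Edge p u w → Edge r u w
      edgeʳ : ∀ {u w} → Edge q u w → Edge r u w
      meet  : v ∈ᵖ p → v ∈ᵖ q → v ≡ z

  mkJoin : ∀ {r : List A} (t : Trail x l z) (ul : Unique l) (s : Trail z m y) (um : Unique m)
    (tr : Trail x r y) (ur : Unique r) → r ≡ glue t m → (∀ {v} → v ∈ l → v ∈ m → v ≡ z) →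
    Join (path t ul) (path s um) (path tr ur)
  mkJoin t ul s um tr ur refl d = record
    { ∈⁻    = ∈-glue⁻ t
    ; ∈ˡ    = ∈-glue⁺ˡ t s
    ; ∈ʳ    = ∈-glue⁺ʳ t
    ; edge⁻ = λ e → edge-++⁻ _ (edge-resp (pairs-glue t s) e)
    ; edgeˡ = λ e → edge-resp (sym (pairs-glue t s)) (edge-++⁺ˡ e)
    ; edgeʳ = λ e → edge-resp (sym (pairs-glue t s)) (edge-++⁺ʳ _ e)
    ; meet  = d }

  join : (p : Path x z) (q : Path z y) → (∀ {v} → v ∈ᵖ p → v ∈ᵖ q → v ≡ z) →
    Σ (Path x y) (Join p q)
  join (path t ul) (path s um) d =
    path (glue-trail t s) (glue-unique t ul um d) , mkJoin t ul s um _ _ refl d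

  split : (p : Path x y) → z ∈ᵖ p → Σ (Path x z) λ q → Σ (Path z y) λ r → Join q r p
  split p@(path t ul) z∈ =
    let _ , _ , t₁ , u₁ , t₂ , u₂ , eq , d = at t ul z∈
    in path t₁ u₁ , path t₂ u₂ , mkJoin t₁ u₁ t₂ u₂ t ul eq d
    where
    at : {x y z : A} {l : List A} → Trail x l y → Unique l → z ∈ l →
      Σ (List A) λ k → Σ (List A) λ m → Σ (Trail x k z) λ t₁ → Unique k × Trail z m y × Unique m ×
      l ≡ glue t₁ m × (∀ {v} → v ∈ k → v ∈ m → v ≡ z)
    at t@stop     ul (here refl) = _ , _ , stop , [] ∷ [] , t , ul , refl , λ { (here eq) _ → eq }
    at t@(go _)   ul (here refl) = _ , _ , stop , [] ∷ [] , t , ul , refl , λ { (here eq) _ → eq }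
    at (go {l = l} t) ul (there i) with at t (unique-tail ul) i
    ... | k , m , t₁ , u₁ , t₂ , u₂ , eq , d =
      _ , m , go t₁ , ∷-unique (λ j → ∉-of-unique ul (back (∈-glue⁺ˡ t₁ t₂ j))) u₁ , t₂ , u₂ , cong (_ ∷_) eq ,
      λ { (here refl) j → ⊥-elim (∉-of-unique ul (back (∈-glue⁺ʳ t₁ j))) ; (there h) j → d h j }
      where
      back : ∀ {v} → v ∈ glue t₁ m → v ∈ l
      back = ∈-resp (sym eq)

  edgePath : x ≢ y → Path x y
  edgePath x≢y = path (go stop) (∷-unique (λ { (here eq) → x≢y eq }) ([] ∷ []))

  record Same {A : Set} {x y x' y' : A} (p : Path x y) (q : Path x' y') : Set where
    field
      ∈⇒    : v ∈ᵖ p → v ∈ᵖ q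
      ∈⇐    : v ∈ᵖ q → v ∈ᵖ p
      edge⇒ : ∀ {u w} → Edge p u w → Edge q u w
      edge⇐ : ∀ {u w} → Edge q u w → Edge p u w

  -- The reversed tail is joined to the edge from its end back to `x`, so the facts about reversal
  -- come from `Join`.
  rev-trail : (t : Trail x l y) (ul : Unique l) → Σ (Path y x) (Same (path t ul))
  rev-trail stop ul = path stop ul , record { ∈⇒ = λ i → i ; ∈⇐ = λ i → i ; edge⇒ = λ e → e ; edge⇐ = λ e → e }
  rev-trail {x = x} (go {l = l} t) ul =
    let q , s = rev-trail t (unique-tail ul)
        module S = Same s
        x∉l = ∉-of-unique ul
        r , j = join q (edgePath (λ w≡x → x∉l (subst (_∈ l) w≡x (start∈ t))))
                  (λ { i (here eq) → eq ; i (there (here refl)) → ⊥-elim (x∉l (S.∈⇐ i)) })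
        module J = Join j
        eq = pairs-trail {x = x} t
    in r , record
    { ∈⇒    = λ { (here refl) → J.∈ʳ (there (here refl)) ; (there i) → J.∈ˡ (S.∈⇒ i) }
    ; ∈⇐    = λ i → [ there ∘ S.∈⇐ , (λ { (here refl) → there (start∈ t) ; (there (here refl)) → here refl }) ]′ (J.∈⁻ i)
    ; edge⇒ = λ e → [ (λ { (inj₁ (refl , refl)) → J.edgeʳ (inj₂ (here refl)) ; (inj₂ (refl , refl)) → J.edgeʳ (inj₁ (here refl)) })
                    , J.edgeˡ ∘ S.edge⇒ ]′ (edge-∷⁻ (edge-resp eq e))
    ; edge⇐ = λ e → edge-resp (sym eq)
        ([ edge-there ∘ S.edge⇐ , (λ { (inj₁ (here refl)) → inj₂ (here refl) ; (inj₂ (here refl)) → inj₁ (here refl) }) ]′ (J.edge⁻ e)) }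

  rev : (p : Path x y) → Σ (Path y x) (Same p)
  rev (path t ul) = rev-trail t ul

  trail-snoc : ∀ (x : A) m {y} → Trail x (x ∷ m ++ y ∷ []) y
  trail-snoc x []      = go stop
  trail-snoc x (a ∷ m) = go (trail-snoc a m)

  unsnoc-trail : Trail x l y → ∃ λ m → l ≡ m ++ y ∷ []
  unsnoc-trail stop           = [] , refl
  unsnoc-trail {x = x} (go t) = let m , eq = unsnoc-trail t in x ∷ m , cong (x ∷_) eq

  interior : (p : Path x y) → x ≢ y → ∃ λ m → verts p ≡ x ∷ m ++ y ∷ []
  interior (path stop   _) x≢y = ⊥-elim (x≢y refl)
  interior (path (go t) _) x≢y = let m , eq = unsnoc-trail t in m , cong (_ ∷_) eq

  ∈-snoc : ∀ {a : A} (m : List A) {b} → v ∈ a ∷ m ++ b ∷ [] → v ≡ a ⊎ v ≡ b ⊎ v ∈ m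
  ∈-snoc m (here eq) = inj₁ eq
  ∈-snoc m (there i) with ∈-++⁻ m i
  ... | inj₁ j         = inj₂ (inj₂ j)
  ... | inj₂ (here eq) = inj₂ (inj₁ eq)

  unique-++ˡ : (l : List A) → Unique (l ++ m) → Unique l
  unique-++ˡ []      u = []
  unique-++ˡ (x ∷ l) u = ∷-unique (∉-of-unique u ∘ ∈-++⁺ˡ) (unique-++ˡ l (unique-tail u))

  unique-↭ : l ↭ m → Unique l → Unique m
  unique-↭ p = PermSetoid.Unique-resp-↭ (setoid _) (↭⇒↭ₛ p)

  -- On a simple path `x` occurs only in first place and `y` only in last place, so an edge between
  -- them must be the first pair and end the path.
  edge-trivial : ∀ {x y : A} (m : List A) → Unique (x ∷ m ++ y ∷ []) →
    EdgeIn (pairs (x ∷ m ++ y ∷ [])) x y → m ≡ []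
  edge-trivial []      u e = refl
  edge-trivial (c ∷ m) u e with edge-∷⁻ e
  ... | inj₁ (inj₁ (_ , refl)) = ⊥-elim (∉-of-unique (unique-tail u) (∈-++⁺ʳ m (here refl)))
  ... | inj₁ (inj₂ (refl , _)) = ⊥-elim (∉-of-unique u (here refl))
  ... | inj₂ e'                = ⊥-elim (∉-of-unique u (proj₁ (edge-∈ _ e')))

  cpairs-split : (x : A) (k : List A) (y : A) (m : List A) →
    cpairs (x ∷ k ++ y ∷ m) ≡ pairs (x ∷ k ++ y ∷ []) ++ pairs (y ∷ m ++ x ∷ [])
  cpairs-split x k y m = trans (cong (λ l → pairs (x ∷ l)) (++-assoc k (y ∷ m) (x ∷ [])))
                               (pairs-++ (x ∷ k) y (m ++ x ∷ []))

  -- Stands for "without loss of generality the cycle starts at `v`". Only edge membership is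
  -- transported, since rotation permutes the list of pairs.
  record Rotation {A : Set} (l : List A) (v : A) : Set where
    field
      rest  : List A
      perm  : l ↭ v ∷ rest
      edge⇒ : ∀ {u w} → EdgeIn (cpairs l) u w → EdgeIn (cpairs (v ∷ rest)) u w
      edge⇐ : ∀ {u w} → EdgeIn (cpairs (v ∷ rest)) u w → EdgeIn (cpairs l) u w

  rotate : v ∈ l → Rotation l v
  rotate {v = v} i with ∈-∃++ i
  ... | [] , l₂ , refl = record { rest = l₂ ; perm = ↭-refl ; edge⇒ = λ e → e ; edge⇐ = λ e → e }
  ... | c ∷ l₁ , l₂ , refl = record
    { rest  = l₂ ++ c ∷ l₁
    ; perm  = ++-comm (c ∷ l₁) (v ∷ l₂)
    ; edge⇒ = λ e → edge-resp (sym (cpairs-split v l₂ c l₁))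
        (edge-swap (pairs (c ∷ l₁ ++ v ∷ [])) (edge-resp (cpairs-split c l₁ v l₂) e))
    ; edge⇐ = λ e → edge-resp (sym (cpairs-split c l₁ v l₂))
        (edge-swap (pairs (v ∷ l₂ ++ c ∷ [])) (edge-resp (cpairs-split v l₂ c l₁) e)) }

  cedge-∈ : (l : List A) → ∀ {u w} → EdgeIn (cpairs l) u w → u ∈ l
  cedge-∈ []      (inj₁ ())
  cedge-∈ []      (inj₂ ())
  cedge-∈ (c ∷ l) e with ∈-snoc l (proj₁ (edge-∈ (c ∷ l ++ c ∷ []) e))
  ... | inj₁ refl        = here refl
  ... | inj₂ (inj₁ refl) = here refl
  ... | inj₂ (inj₂ j)    = there j

  lookup-injective : Unique l → ∀ i j → lookup l i ≡ lookup l j → i ≡ j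
  lookup-injective {l = _ ∷ _} u zero    zero    eq = refl
  lookup-injective {l = _ ∷ l} u zero    (suc j) eq = ⊥-elim (∉-of-unique u (subst (_∈ l) (sym eq) (∈-lookup j)))
  lookup-injective {l = _ ∷ l} u (suc i) zero    eq = ⊥-elim (∉-of-unique u (subst (_∈ l) eq (∈-lookup i)))
  lookup-injective {l = _ ∷ _} u (suc i) (suc j) eq = cong suc (lookup-injective (unique-tail u) i j eq)

  start-or-edge : Trail x l y → v ∈ l → v ≡ x ⊎ ∃ λ u → EdgeIn (pairs l) v u
  start-or-edge stop   (here eq) = inj₁ eq
  start-or-edge (go t) (here eq) = inj₁ eq
  start-or-edge {x = x} (go t) (there i) with start-or-edge t i
  ... | inj₁ refl    = inj₂ (x , edge-resp (sym (pairs-trail t)) (inj₂ (here refl)))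
  ... | inj₂ (u , e) = inj₂ (u , edge-resp (sym (pairs-trail t)) (edge-there e))

open Paths
open Path

module _ (G : Graph) where
  open Graph G using (n; adj)
  open import Data.List.Membership.DecPropositional (_≟_ {n}) using (_∈?_)
  open import Data.List.Membership.DecPropositional (≡-dec (_≟_ {n}) (_≟_ {n})) using () renaming (_∈?_ to _∈²?_)

  -- Cycles and their decomposition into two arcs

  adj-sym : ∀ {u w} → Adj G u w → Adj G w u
  adj-sym {u} {w} = subst T (Graph.sym G u w)

  adj-of-all : ∀ {l} → All (λ p → Adj G (proj₁ p) (proj₂ p)) l → ∀ {u w} → EdgeIn l u w → Adj G u w
  adj-of-all al (inj₁ i) = All.lookup al i
  adj-of-all al (inj₂ i) = adj-sym (All.lookup al i)

  all-of-adj : ∀ {l} → (∀ {u w} → EdgeIn l u w → Adj G u w) → All (λ p → Adj G (proj₁ p) (proj₂ p)) l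
  all-of-adj h = All.tabulate (h ∘ inj₁)

  -- The cycle is the union of two internally disjoint paths with common ends. `notTwin` excludes
  -- the degenerate pair formed by one edge taken twice.
  record Arcs (C : Cycle G) {x y : Fin n} (p q : Path x y) : Set where
    field
      ∈⁻      : ∀ {v} → v ∈ cverts C → v ∈ᵖ p ⊎ v ∈ᵖ q
      ∈ˡ      : ∀ {v} → v ∈ᵖ p → v ∈ cverts C
      ∈ʳ      : ∀ {v} → v ∈ᵖ q → v ∈ cverts C
      edge⁻   : ∀ {u w} → CycEdge G C u w → Edge p u w ⊎ Edge q u w
      edgeˡ   : ∀ {u w} → Edge p u w → CycEdge G C u w
      edgeʳ   : ∀ {u w} → Edge q u w → CycEdge G C u w
      meet    : ∀ {v} → v ∈ᵖ p → v ∈ᵖ q → v ≡ x ⊎ v ≡ y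
      notTwin : Edge p x y → Edge q x y → ⊥

  arcs-swap : ∀ {C x y} {p q : Path x y} → Arcs C p q → Arcs C q p
  arcs-swap a = record
    { ∈⁻ = λ i → Sum.swap (∈⁻ i) ; ∈ˡ = ∈ʳ ; ∈ʳ = ∈ˡ ; edge⁻ = λ e → Sum.swap (edge⁻ e) ; edgeˡ = edgeʳ ; edgeʳ = edgeˡ
    ; meet = λ i j → meet j i ; notTwin = λ e f → notTwin f e }
    where open Arcs a

  cycle-adj : (C : Cycle G) → ∀ {u w} → CycEdge G C u w → Adj G u w
  cycle-adj C = adj-of-all (cadj C)

  mkCycle : ∀ {x y} (p q : Path x y) → x ≢ y →
    (∀ {v} → v ∈ᵖ p → v ∈ᵖ q → v ≡ x ⊎ v ≡ y) → (Edge p x y → Edge q x y → ⊥) →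
    (∀ {u w} → Edge p u w → Adj G u w) → (∀ {u w} → Edge q u w → Adj G u w) →
    Σ (Cycle G) λ C → Arcs C p q
  mkCycle {x} {y} p@(path {l} t ul) q x≢y meet notTwin ap aq with rev q
  ... | path {l'} t' ul' , s with interior p x≢y | interior (path t' ul') (x≢y ∘ sym)
  ... | k , refl | m , refl = C , record
    { ∈⁻ = λ { (here refl) → inj₁ (here refl) ; (there i) → [ (λ j → inj₁ (there (∈-++⁺ˡ j))) ,
             (λ { (here refl) → inj₁ (there (∈-++⁺ʳ k (here refl))) ; (there j) → inj₂ (S.∈⇐ (there (∈-++⁺ˡ j))) }) ]′ (∈-++⁻ k i) }
    ; ∈ˡ = inˡ
    ; ∈ʳ = inʳ ∘ S.∈⇒
    ; edge⁻ = λ e → Sum.map₂ S.edge⇐ (edge-++⁻ (pairs (x ∷ k ++ y ∷ [])) (edge-resp eq e))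
    ; edgeˡ = λ e → edge-resp (sym eq) (edge-++⁺ˡ e)
    ; edgeʳ = λ e → edge-resp (sym eq) (edge-++⁺ʳ (pairs (x ∷ k ++ y ∷ [])) (S.edge⇒ e))
    ; meet = meet ; notTwin = notTwin }
    where
    module S = Same s
    eq = cpairs-split x k y m
    inˡ : ∀ {v} → v ∈ x ∷ k ++ y ∷ [] → v ∈ x ∷ k ++ y ∷ m
    inˡ i with ∈-snoc k i
    ... | inj₁ refl        = here refl
    ... | inj₂ (inj₁ refl) = there (∈-++⁺ʳ k (here refl))
    ... | inj₂ (inj₂ j)    = there (∈-++⁺ˡ j)
    inʳ : ∀ {v} → v ∈ y ∷ m ++ x ∷ [] → v ∈ x ∷ k ++ y ∷ m
    inʳ i with ∈-snoc m i
    ... | inj₁ refl        = there (∈-++⁺ʳ k (here refl))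
    ... | inj₂ (inj₁ refl) = here refl
    ... | inj₂ (inj₂ j)    = there (∈-++⁺ʳ k (there j))
    disj : ∀ {v} → v ∈ x ∷ k ++ y ∷ [] × v ∈ m → ⊥
    disj (i , j) with meet i (S.∈⇐ (there (∈-++⁺ˡ j)))
    ... | inj₁ refl = ∉-of-unique (unique-↭ (++-comm (y ∷ m) (x ∷ [])) ul') (there j)
    ... | inj₂ refl = ∉-of-unique ul' (∈-++⁺ˡ j)
    uniq : Unique (x ∷ k ++ y ∷ m)
    uniq = subst Unique (++-assoc (x ∷ k) (y ∷ []) m)
      (Unique.++⁺ ul (unique-tail (unique-++ˡ (y ∷ m) ul')) disj)
    -- Fewer than three vertices means that both interiors are empty, so that both paths are the
    -- edge `xy`; `notTwin` forbids it.
    len : ∀ k m → (EdgeIn (pairs (x ∷ k ++ y ∷ [])) x y → EdgeIn (pairs (y ∷ m ++ x ∷ [])) x y → ⊥) →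
      3 ≤ length (x ∷ k ++ y ∷ m)
    len []          []      nb = ⊥-elim (nb (inj₁ (here refl)) (inj₂ (here refl)))
    len []          (_ ∷ _) nb = s≤s (s≤s (s≤s z≤n))
    len (_ ∷ [])    m       nb = s≤s (s≤s (s≤s z≤n))
    len (_ ∷ _ ∷ _) m       nb = s≤s (s≤s (s≤s z≤n))
    C : Cycle G
    C = record
      { cverts = x ∷ k ++ y ∷ m
      ; clen   = len k m (λ e f → notTwin e (S.edge⇐ f))
      ; cuniq  = uniq
      ; cadj   = all-of-adj (λ e →
          [ ap , aq ∘ S.edge⇐ ]′ (edge-++⁻ (pairs (x ∷ k ++ y ∷ [])) (edge-resp eq e))) }

  cycle-arcs : (C : Cycle G) → ∀ {x y} → x ∈ cverts C → y ∈ cverts C → x ≢ y →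
    Σ (Path x y) λ p → Σ (Path x y) λ q → Arcs C p q
  cycle-arcs C {x} {y} x∈ y∈ x≢y with rotate x∈
  ... | record { rest = r ; perm = perm ; edge⇒ = e⇒ ; edge⇐ = e⇐ } with ∈-resp-↭ perm y∈
  ... | here refl = ⊥-elim (x≢y refl)
  ... | there j with ∈-∃++ j
  ... | k , m , refl = p , proj₁ (rev q) , record
    { ∈⁻ = λ i → ins (∈-resp-↭ perm i)
    ; ∈ˡ = λ i → ∈-resp-↭ (↭-sym perm) (∈-resp (++-assoc (x ∷ k) (y ∷ []) m) (∈-++⁺ˡ i))
    ; ∈ʳ = λ i → ∈-resp-↭ (↭-sym perm) (∈-resp-↭ (++-comm (y ∷ m) (x ∷ k)) (∈-resp (++-assoc (y ∷ m) (x ∷ []) k) (∈-++⁺ˡ (S.∈⇐ i))))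
    ; edge⁻ = λ e → Sum.map₂ S.edge⇒ (edge-++⁻ (pairs (x ∷ k ++ y ∷ [])) (edge-resp eq (e⇒ e)))
    ; edgeˡ = λ e → e⇐ (edge-resp (sym eq) (edge-++⁺ˡ e))
    ; edgeʳ = λ e → e⇐ (edge-resp (sym eq) (edge-++⁺ʳ (pairs (x ∷ k ++ y ∷ [])) (S.edge⇐ e)))
    ; meet = λ i i' → meets i (S.∈⇐ i')
    ; notTwin = λ e f → tooShort (edge-trivial k up e) (edge-trivial m uq (edge-sym (S.edge⇐ f))) }
    where
    eq = cpairs-split x k y m
    u = unique-↭ perm (cuniq C)
    up : Unique (x ∷ k ++ y ∷ [])
    up = unique-++ˡ (x ∷ k ++ y ∷ []) (subst Unique (sym (++-assoc (x ∷ k) (y ∷ []) m)) u)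
    u' : Unique ((y ∷ m ++ x ∷ []) ++ k)
    u' = subst Unique (sym (++-assoc (y ∷ m) (x ∷ []) k)) (unique-↭ (++-comm (x ∷ k) (y ∷ m)) u)
    uq : Unique (y ∷ m ++ x ∷ [])
    uq = unique-++ˡ (y ∷ m ++ x ∷ []) u'
    p : Path x y
    p = path (trail-snoc x k) up
    q : Path y x
    q = path (trail-snoc y m) uq
    module S = Same (proj₂ (rev q))
    ins : ∀ {v} → v ∈ x ∷ k ++ y ∷ m → v ∈ᵖ p ⊎ v ∈ᵖ proj₁ (rev q)
    ins (here refl) = inj₁ (here refl)
    ins (there i) with ∈-++⁻ k i
    ... | inj₁ h           = inj₁ (there (∈-++⁺ˡ h))
    ... | inj₂ (here refl) = inj₁ (there (∈-++⁺ʳ k (here refl)))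
    ... | inj₂ (there h)   = inj₂ (S.∈⇒ (there (∈-++⁺ˡ h)))
    meets : ∀ {v} → v ∈ x ∷ k ++ y ∷ [] → v ∈ y ∷ m ++ x ∷ [] → v ≡ x ⊎ v ≡ y
    meets i i' with ∈-snoc k i | i'
    ... | inj₁ e        | _ = inj₁ e
    ... | inj₂ (inj₁ e) | _ = inj₂ e
    ... | inj₂ (inj₂ h) | i' = ⊥-elim (apart u' i' h)
      where
      apart : ∀ {v : Fin n} {l k} → Unique (l ++ k) → v ∈ l → v ∈ k → ⊥
      apart {l = _ ∷ l} ulk (here refl) h = ∉-of-unique ulk (∈-++⁺ʳ l h)
      apart {l = _ ∷ l} ulk (there i)   h = apart (unique-tail ulk) i h
    -- Two arcs without interior would leave a cycle on two vertices.
    tooShort : k ≡ [] → m ≡ [] → ⊥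
    tooShort refl refl with subst (3 ≤_) (↭-length perm) (clen C)
    ... | s≤s (s≤s ())

  record TwoNeighbours (C : Cycle G) (v : Fin n) : Set where
    field
      left right : Fin n
      left≢right : left ≢ right
      edgeˡ      : CycEdge G C v left
      edgeʳ      : CycEdge G C v right
      only       : ∀ {z} → CycEdge G C v z → z ≡ left ⊎ z ≡ right

  -- After rotating `v` to the front, its neighbours are the first and the last of the remaining
  -- vertices; these differ because at least two remain.
  cycle-neighbours : (C : Cycle G) → ∀ {v} → v ∈ cverts C → TwoNeighbours C v
  cycle-neighbours C {v} i with rotate i
  ... | record { rest = [] ; perm = perm } = ⊥-elim (case subst (3 ≤_) (↭-length perm) (clen C) of λ { (s≤s ()) })
  ... | record { rest = a ∷ r ; perm = perm ; edge⇒ = e⇒ ; edge⇐ = e⇐ } with initLast r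
  ... | []      = ⊥-elim (case subst (3 ≤_) (↭-length perm) (clen C) of λ { (s≤s (s≤s ())) })
  ... | m ∷ʳ′ b = record
    { left = a ; right = b
    ; left≢right = λ { refl → ∉-of-unique (unique-tail u) (∈-++⁺ʳ m (here refl)) }
    ; edgeˡ = e⇐ (inj₁ (here refl))
    ; edgeʳ = e⇐ (edge-resp (sym eq) (edge-++⁺ʳ (pairs (v ∷ a ∷ m ++ b ∷ [])) (inj₂ (here refl))))
    ; only = λ e → here-only (edge-++⁻ (pairs (v ∷ a ∷ m ++ b ∷ [])) (edge-resp eq (e⇒ e))) }
    where
    u = unique-↭ perm (cuniq C)
    eq : cpairs (v ∷ a ∷ m ++ b ∷ []) ≡ pairs (v ∷ a ∷ m ++ b ∷ []) ++ (b , v) ∷ []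
    eq = cpairs-split v (a ∷ m) b []
    here-only : ∀ {z} → EdgeIn (pairs (v ∷ a ∷ m ++ b ∷ [])) v z ⊎ EdgeIn ((b , v) ∷ []) v z → z ≡ a ⊎ z ≡ b
    here-only (inj₂ (inj₁ (here refl))) = inj₂ refl
    here-only (inj₂ (inj₂ (here refl))) = inj₂ refl
    here-only (inj₁ e) with edge-∷⁻ e
    ... | inj₁ (inj₁ (_ , refl)) = inj₁ refl
    ... | inj₁ (inj₂ (refl , refl)) = ⊥-elim (∉-of-unique u (here refl))
    ... | inj₂ e' = ⊥-elim (∉-of-unique u (proj₁ (edge-∈ _ e')))

  cycle-edge-ends : (C : Cycle G) → ∀ {u w} → CycEdge G C u w → u ∈ cverts C × w ∈ cverts C
  cycle-edge-ends C e = cedge-∈ (cverts C) e , cedge-∈ (cverts C) (edge-sym e)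

  cycle-hasEdge : (C : Cycle G) → ∃ λ u → ∃ λ w → CycEdge G C u w
  cycle-hasEdge record { cverts = _ ∷ []    ; clen = s≤s () }
  cycle-hasEdge record { cverts = c ∷ d ∷ _ } = c , d , inj₁ (here refl)

  -- Theta graphs, ears and families of cycles

  private variable
    t : ℕ

  path-≢ : ∀ {x y u w : Fin n} (p : Path x y) → Edge p u w → u ≢ w
  path-≢ p = edge-≢ (simple p)

  firstEdge : ∀ {x y : Fin n} (p : Path x y) → x ≢ y → ∃ λ z → Edge p x z
  firstEdge (path stop        _) x≢y = ⊥-elim (x≢y refl)
  firstEdge (path (go {w} t) _) x≢y = w , edge-resp (sym (pairs-trail t)) (inj₁ (here refl))

  -- Any number of arcs is allowed, so that thetas grow arc by arc from `noArcs`. `single` says in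
  -- terms of edges that at most one arc has length one, the form that edge-disjointness uses.
  record Θ (t : ℕ) : Set where
    field
      src tgt : Fin n
      src≢tgt : src ≢ tgt
      arc     : Fin t → Path src tgt
      meet    : ∀ {i j v} → i ≢ j → v ∈ᵖ arc i → v ∈ᵖ arc j → v ≡ src ⊎ v ≡ tgt
      single  : ∀ {i j} → i ≢ j → Edge (arc i) src tgt → Edge (arc j) src tgt → ⊥
      arc-adj : ∀ {i u w} → Edge (arc i) u w → Adj G u w

  open Θ

  ΘV : Θ t → Fin n → Set
  ΘV θ v = ∃ λ i → v ∈ᵖ arc θ i

  ΘE : Θ t → Fin n → Fin n → Set
  ΘE θ u w = ∃ λ i → Edge (arc θ i) u w

  -- The ends of a common edge lie on both arcs, so both are branch vertices. The edge would join
  -- `src` to `tgt`, and `single` keeps it from lying on two arcs.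
  arcs-edge-disjoint : (θ : Θ t) → ∀ {i j u w} → i ≢ j → Edge (arc θ i) u w → Edge (arc θ j) u w → ⊥
  arcs-edge-disjoint θ {i} {j} i≢j e f
    with meet θ i≢j (proj₁ (edge-ends (arc θ i) e)) (proj₁ (edge-ends (arc θ j) f))
       | meet θ i≢j (proj₂ (edge-ends (arc θ i) e)) (proj₂ (edge-ends (arc θ j) f))
  ... | inj₁ refl | inj₁ refl = path-≢ (arc θ i) e refl
  ... | inj₁ refl | inj₂ refl = single θ i≢j e f
  ... | inj₂ refl | inj₁ refl = single θ i≢j (edge-sym e) (edge-sym f)
  ... | inj₂ refl | inj₂ refl = path-≢ (arc θ i) e refl

  -- The first edge represents its arc: an even set supported on the theta is constant along an arc
  -- and can be tested there.
  next : Θ t → Fin t → Fin n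
  next θ i = proj₁ (firstEdge (arc θ i) (src≢tgt θ))

  next-edge : (θ : Θ t) → ∀ i → Edge (arc θ i) (src θ) (next θ i)
  next-edge θ i = proj₂ (firstEdge (arc θ i) (src≢tgt θ))

  ends-∉-interior : ∀ {x y : Fin n} {m v} → Unique (x ∷ m ++ y ∷ []) → v ∈ m → v ≡ x ⊎ v ≡ y → ⊥
  ends-∉-interior u i (inj₁ refl) = ∉-of-unique u (∈-++⁺ˡ i)
  ends-∉-interior {x} {y} {m} u i (inj₂ refl) =
    ∉-of-unique (unique-↭ (++-comm (x ∷ m) (y ∷ [])) u) (there i)

  isPath : ∀ {x y} (p : Path x y) → (∀ {u w} → Edge p u w → Adj G u w) → ∀ {m} →
    verts p ≡ x ∷ m ++ y ∷ [] → IsPath G x m y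
  isPath p pa eq = subst Unique eq (simple p) , all-of-adj (pa ∘ edge-resp (cong pairs (sym eq)))

  module ToTheta (θ : Θ t) where
    mid : Fin t → List (Fin n)
    mid i = proj₁ (interior (arc θ i) (src≢tgt θ))

    mid-eq : ∀ i → verts (arc θ i) ≡ src θ ∷ mid i ++ tgt θ ∷ []
    mid-eq i = proj₂ (interior (arc θ i) (src≢tgt θ))

    mid⇒arc : ∀ {v} i → v ∈ mid i → v ∈ᵖ arc θ i
    mid⇒arc i j = ∈-resp (sym (mid-eq i)) (there (∈-++⁺ˡ j))

    empty⇒edge : ∀ i → mid i ≡ [] → Edge (arc θ i) (src θ) (tgt θ)
    empty⇒edge i eq = edge-resp (cong pairs (sym (trans (mid-eq i) (cong (λ m → src θ ∷ m ++ tgt θ ∷ []) eq))))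
                                (inj₁ (here refl))

    theta : Theta G t
    theta = record
      { tx = src θ ; tys = tgt θ ; tx≢ty = src≢tgt θ ; mids = mid
      ; paths = λ i → isPath (arc θ i) (arc-adj θ) (mid-eq i)
      ; disjoint = λ i j i≢j v v∈i v∈j → ends-∉-interior (subst Unique (mid-eq i) (simple (arc θ i))) v∈i
          (meet θ i≢j (mid⇒arc i v∈i) (mid⇒arc j v∈j))
      ; atMostOne1 = λ i j mi mj → decidable-stable (i ≟ j)
          (λ i≢j → single θ i≢j (empty⇒edge i mi) (empty⇒edge j mj)) }

    V⇒ : ∀ {v} → ΘV θ v → ThetaV G theta v
    V⇒ (i , j) with ∈-snoc (mid i) (∈-resp (mid-eq i) j)
    ... | inj₁ eq        = inj₁ eq
    ... | inj₂ (inj₁ eq) = inj₂ (inj₁ eq)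
    ... | inj₂ (inj₂ h)  = inj₂ (inj₂ (i , h))

    -- An arc is supplied to hold the branch vertices: for `t = 0` they belong to `ThetaV` but not
    -- to `ΘV`.
    V⇐ : Fin t → ∀ {v} → ThetaV G theta v → ΘV θ v
    V⇐ i (inj₁ refl)               = i , start∈ (trail (arc θ i))
    V⇐ i (inj₂ (inj₁ refl))        = i , end∈ (trail (arc θ i))
    V⇐ _ (inj₂ (inj₂ (i , j))) = i , mid⇒arc i j

    E⇒ : ∀ {u w} → ΘE θ u w → ThetaE G theta u w
    E⇒ (i , e) = i , edge-resp (cong pairs (mid-eq i)) e

    E⇐ : ∀ {u w} → ThetaE G theta u w → ΘE θ u w
    E⇐ (i , e) = i , edge-resp (cong pairs (sym (mid-eq i))) e

  module FromTheta (θ : Theta G t) where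
    Θ-of : Θ t
    Θ-of = record
      { src = tx θ ; tgt = tys θ ; src≢tgt = tx≢ty θ
      ; arc = λ i → path (trail-snoc (tx θ) (mids θ i)) (proj₁ (paths θ i))
      ; meet = meets
      ; single = λ {i} {j} i≢j e f → i≢j (atMostOne1 θ i j
          (edge-trivial (mids θ i) (proj₁ (paths θ i)) e) (edge-trivial (mids θ j) (proj₁ (paths θ j)) f))
      ; arc-adj = λ {i} → adj-of-all (proj₂ (paths θ i)) }
      where
      meets : ∀ {i j v} → i ≢ j → v ∈ pathList G (tx θ) (mids θ i) (tys θ) →
        v ∈ pathList G (tx θ) (mids θ j) (tys θ) → v ≡ tx θ ⊎ v ≡ tys θ
      meets {i} {j} {v} i≢j vi vj with ∈-snoc (mids θ i) vi | ∈-snoc (mids θ j) vj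
      ... | inj₁ eq        | _              = inj₁ eq
      ... | inj₂ (inj₁ eq) | _              = inj₂ eq
      ... | inj₂ (inj₂ _)  | inj₁ eq        = inj₁ eq
      ... | inj₂ (inj₂ _)  | inj₂ (inj₁ eq) = inj₂ eq
      ... | inj₂ (inj₂ h)  | inj₂ (inj₂ h') = ⊥-elim (disjoint θ i j i≢j v h h')

    V⇒ : ∀ {v} → ΘV Θ-of v → ThetaV G θ v
    V⇒ (i , j) with ∈-snoc (mids θ i) j
    ... | inj₁ eq        = inj₁ eq
    ... | inj₂ (inj₁ eq) = inj₂ (inj₁ eq)
    ... | inj₂ (inj₂ h)  = inj₂ (inj₂ (i , h))

    V⇐ : Fin t → ∀ {v} → ThetaV G θ v → ΘV Θ-of v
    V⇐ i (inj₁ refl)           = i , here refl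
    V⇐ i (inj₂ (inj₁ refl))    = i , there (∈-++⁺ʳ (mids θ i) (here refl))
    V⇐ _ (inj₂ (inj₂ (i , j))) = i , there (∈-++⁺ˡ j)

  record EarOf (FV : Fin n → Set) (FE : Fin n → Fin n → Set) : Set where
    field
      {foot head} : Fin n
      foot≢head   : foot ≢ head
      foot∈       : FV foot
      head∈       : FV head
      body        : Path foot head
      inner       : ∀ {v} → v ∈ᵖ body → FV v → v ≡ foot ⊎ v ≡ head
      fresh       : ∀ {u w} → Edge body u w → ¬ FE u w
      body-adj    : ∀ {u w} → Edge body u w → Adj G u w

  open EarOf

  Spans : (θ : Θ t) → Fin n → Fin n → Set
  Spans θ c d = (c ≡ src θ × d ≡ tgt θ) ⊎ (c ≡ tgt θ × d ≡ src θ)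

  module ToEar (θ : Θ (suc t)) (Q : EarOf (ΘV θ) (ΘE θ)) (nt : ¬ Spans θ (foot Q) (head Q)) where
    open ToTheta θ

    emid-eq : ∃ λ m → verts (body Q) ≡ foot Q ∷ m ++ head Q ∷ []
    emid-eq = interior (body Q) (foot≢head Q)

    ear : Ear G theta
    ear = record
      { ea = foot Q ; eb = head Q ; ea≢eb = foot≢head Q
      ; eaIn = V⇒ (foot∈ Q) ; ebIn = V⇒ (head∈ Q)
      ; emid = proj₁ emid-eq
      ; epath = isPath (body Q) (body-adj Q) (proj₂ emid-eq)
      ; einner = λ v i vθ → ends-∉-interior (subst Unique (proj₂ emid-eq) (simple (body Q))) i
          (inner Q (∈-resp (sym (proj₂ emid-eq)) (there (∈-++⁺ˡ i))) (V⇐ zero vθ))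
      ; eedges = λ u w e f → fresh Q (edge-resp (cong pairs (sym (proj₂ emid-eq))) e) (E⇐ f)
      ; notBoth = nt }

  addArc : (θ : Θ t) (q : Path (src θ) (tgt θ)) →
    (∀ {v} → v ∈ᵖ q → ΘV θ v → v ≡ src θ ⊎ v ≡ tgt θ) → (∀ {u w} → Edge q u w → ¬ ΘE θ u w) →
    (∀ {u w} → Edge q u w → Adj G u w) → Θ (suc t)
  addArc {t} θ q inn fr qa = record
    { src = src θ ; tgt = tgt θ ; src≢tgt = src≢tgt θ ; arc = arc'
    ; meet = λ {i} {j} → meet' i j ; single = λ {i} {j} → single' i j ; arc-adj = λ {i} → adj' i }
    where
    arc' : Fin (suc t) → Path (src θ) (tgt θ)
    arc' zero    = q
    arc' (suc i) = arc θ i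
    meet' : ∀ i j {v} → i ≢ j → v ∈ᵖ arc' i → v ∈ᵖ arc' j → v ≡ src θ ⊎ v ≡ tgt θ
    meet' zero    zero    ne _ _  = ⊥-elim (ne refl)
    meet' zero    (suc j) ne i i' = inn i (j , i')
    meet' (suc j) zero    ne i i' = inn i' (j , i)
    meet' (suc _) (suc _) ne i i' = meet θ (ne ∘ cong suc) i i'
    single' : ∀ i j → i ≢ j → Edge (arc' i) (src θ) (tgt θ) → Edge (arc' j) (src θ) (tgt θ) → ⊥
    single' zero    zero    ne _ _ = ne refl
    single' zero    (suc j) ne e f = fr e (j , f)
    single' (suc j) zero    ne e f = fr f (j , e)
    single' (suc _) (suc _) ne e f = single θ (ne ∘ cong suc) e f
    adj' : ∀ i {u w} → Edge (arc' i) u w → Adj G u w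
    adj' zero    = qa
    adj' (suc _) = arc-adj θ

  -- `P` is an invariant of all members; it separates them from the cycles of another family in
  -- `append`.
  record Family (m : ℕ) (u w : Fin n) (P : Cycle G → Set) : Set where
    field
      cycle    : Fin m → Cycle G
      through  : ∀ i → CycEdge G (cycle i) u w
      distinct : ∀ {i j} → i ≢ j → ¬ SameCycle G (cycle i) (cycle j)
      property : ∀ i → P (cycle i)

  family-bound : ∀ {k u w P} → Family (suc k) u w P → KCactus G k → ⊥
  family-bound {u = u} {w} F (_ , h) =
    let i , j , i≢j , same = h u w (cycle-adj (cycle zero) (through zero)) cycle through
    in distinct i≢j same
    where open Family F

  module _ (θ : Θ t) {i j : Fin t} (i≢j : i ≢ j) where
    twoArcs : Σ (Cycle G) λ C → Arcs C (arc θ i) (arc θ j)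
    twoArcs = mkCycle (arc θ i) (arc θ j) (src≢tgt θ) (meet θ i≢j) (single θ i≢j) (arc-adj θ) (arc-adj θ)

  -- Arc `i` is paired with each other arc, enumerated by `punchIn i`; the first edge of the second
  -- arc tells the cycles apart. Containment in `θ` and the presence of the whole arc `i` are
  -- recorded in order to separate this family from others.
  Θ-family : (θ : Θ (suc t)) → ∀ i {u w} → Edge (arc θ i) u w →
    Family t u w (λ C → (∀ {a b} → CycEdge G C a b → ΘE θ a b) × (∀ {a b} → Edge (arc θ i) a b → CycEdge G C a b))
  Θ-family θ i e = record
    { cycle    = λ j → proj₁ (cyc j)
    ; through  = λ j → Arcs.edgeˡ (proj₂ (cyc j)) e
    ; distinct = dist
    ; property = λ j → (λ f → [ (i ,_) , (punchIn i j ,_) ]′ (Arcs.edge⁻ (proj₂ (cyc j)) f)) , Arcs.edgeˡ (proj₂ (cyc j)) }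
    where
    cyc : ∀ j → Σ (Cycle G) λ C → Arcs C (arc θ i) (arc θ (punchIn i j))
    cyc j = twoArcs θ (punchInᵢ≢i i j ∘ sym)
    dist : ∀ {j k} → j ≢ k → ¬ SameCycle G (proj₁ (cyc j)) (proj₁ (cyc k))
    dist {j} {k} j≢k same =
      let f = next-edge θ (punchIn i j)
          g = Equivalence.to (same _ _) (Arcs.edgeʳ (proj₂ (cyc j)) f)
      in [ arcs-edge-disjoint θ (punchInᵢ≢i i j) f
         , arcs-edge-disjoint θ (j≢k ∘ punchIn-injective i j k) f ]′ (Arcs.edge⁻ (proj₂ (cyc k)) g)

  append : ∀ {m k u w P Q} → Family m u w P → Family k u w Q →
    (∀ {C D} → P C → Q D → ¬ SameCycle G C D) → Family (m + k) u w (λ C → P C ⊎ Q C)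
  append {m} {k} {u} {w} {P} {Q} F H apart = record
    { cycle    = λ i → cyc (splitAt m i)
    ; through  = λ i → thr (splitAt m i)
    ; distinct = λ {i} {j} i≢j → dist (splitAt m i) (splitAt m j)
        (λ eq → i≢j (trans (sym (join-splitAt m k i)) (trans (cong (Fin.join m k) eq) (join-splitAt m k j))))
    ; property = λ i → prop (splitAt m i) }
    where
    module F = Family F
    module H = Family H
    cyc : Fin m ⊎ Fin k → Cycle G
    cyc = [ F.cycle , H.cycle ]′
    thr : ∀ s → CycEdge G (cyc s) u w
    thr (inj₁ i) = F.through i
    thr (inj₂ i) = H.through i
    dist : ∀ s s' → s ≢ s' → ¬ SameCycle G (cyc s) (cyc s')
    dist (inj₁ i) (inj₁ j) ne = F.distinct (ne ∘ cong inj₁)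
    dist (inj₁ i) (inj₂ j) ne = apart (F.property i) (H.property j)
    dist (inj₂ i) (inj₁ j) ne same = apart (F.property j) (H.property i) (λ u w → ⇔-sym (same u w))
    dist (inj₂ i) (inj₂ j) ne = H.distinct (ne ∘ cong inj₂)
    prop : ∀ s → P (cyc s) ⊎ Q (cyc s)
    prop (inj₁ i) = inj₁ (F.property i)
    prop (inj₂ i) = inj₂ (H.property i)

  avoid : (i j : Fin (3 + t)) → ∃ λ k → k ≢ i × k ≢ j
  avoid zero          zero          = suc zero , (λ ()) , (λ ())
  avoid zero          (suc zero)    = suc (suc zero) , (λ ()) , (λ ())
  avoid zero          (suc (suc _)) = suc zero , (λ ()) , (λ ())
  avoid (suc zero)    zero          = suc (suc zero) , (λ ()) , (λ ())
  avoid (suc (suc _)) zero          = suc zero , (λ ()) , (λ ())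
  avoid (suc _)       (suc _)       = zero , (λ ()) , (λ ())

  removeArc : Θ (suc t) → Fin (suc t) → Θ t
  removeArc θ i = record
    { src = src θ ; tgt = tgt θ ; src≢tgt = src≢tgt θ
    ; arc = λ j → arc θ (punchIn i j)
    ; meet = λ {j} {k} j≢k → meet θ (j≢k ∘ punchIn-injective i j k)
    ; single = λ {j} {k} j≢k → single θ (j≢k ∘ punchIn-injective i j k)
    ; arc-adj = arc-adj θ }

  noArcs : ∀ {x y} → x ≢ y → Θ 0
  noArcs {x} {y} x≢y = record
    { src = x ; tgt = y ; src≢tgt = x≢y ; arc = λ () ; meet = λ { {()} } ; single = λ { {()} } ; arc-adj = λ { {()} } }

  -- Viewing a cycle as a theta with two arcs lets an ear turn it into a `θ₃` and brings it under
  -- the counting bound for thetas.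
  module ArcsTheta {C : Cycle G} {x y : Fin n} {p q : Path x y} (x≢y : x ≢ y) (A : Arcs C p q) where
    private module A = Arcs A

    both : ∀ {u w} → Edge p u w → Edge q u w → ⊥
    both f g with A.meet (proj₁ (edge-ends p f)) (proj₁ (edge-ends q g)) | A.meet (proj₂ (edge-ends p f)) (proj₂ (edge-ends q g))
    ... | inj₁ refl | inj₁ refl = path-≢ p f refl
    ... | inj₁ refl | inj₂ refl = A.notTwin f g
    ... | inj₂ refl | inj₁ refl = A.notTwin (edge-sym f) (edge-sym g)
    ... | inj₂ refl | inj₂ refl = path-≢ p f refl

    theta : Θ 2
    theta = addArc (addArc (noArcs x≢y) p (λ { _ (() , _) }) (λ { _ (() , _) }) (λ f → cycle-adj C (A.edgeˡ f)))
      q (λ { i (zero , j) → A.meet j i }) (λ { f (zero , g) → both g f }) (λ f → cycle-adj C (A.edgeʳ f))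

    V⇒ : ∀ {v} → ΘV theta v → v ∈ cverts C
    V⇒ (zero , i)     = A.∈ʳ i
    V⇒ (suc zero , i) = A.∈ˡ i

    E⇒ : ∀ {u w} → ΘE theta u w → CycEdge G C u w
    E⇒ (zero , f)     = A.edgeʳ f
    E⇒ (suc zero , f) = A.edgeˡ f

    E⇐ : ∀ {u w} → CycEdge G C u w → ΘE theta u w
    E⇐ f = [ (λ g → suc zero , g) , (λ g → zero , g) ]′ (A.edge⁻ f)

  -- A second theta graph sharing an edge uw with θ, both on an arc i, whose arc through uw
  -- also runs through the ear: the cycles of the two families are then told apart by the ear.
  record Detour (θ : Θ 3) (Q : EarOf (ΘV θ) (ΘE θ)) : Set where
    field
      {i j}       : Fin 3
      {s₁ s₂ q₁ q₂} : Fin n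
      other       : Θ 3
      shared      : Edge (arc θ i) s₁ s₂
      shared'     : Edge (arc other j) s₁ s₂
      earEdge     : Edge (body Q) q₁ q₂
      earEdge'    : Edge (arc other j) q₁ q₂
      within      : ∀ {u w} → ΘE other u w → ΘE θ u w ⊎ Edge (body Q) u w

  revEar : ∀ {FV FE} → EarOf FV FE → EarOf FV FE
  revEar Q = record
    { foot≢head = foot≢head Q ∘ sym ; foot∈ = head∈ Q ; head∈ = foot∈ Q ; body = proj₁ (rev (body Q))
    ; inner = λ i v → Sum.swap (inner Q (∈⇐ i) v) ; fresh = λ e → fresh Q (edge⇐ e) ; body-adj = λ e → body-adj Q (edge⇐ e) }
    where open Same (proj₂ (rev (body Q)))

  module _ (θ : Θ 3) (Q : EarOf (ΘV θ) (ΘE θ)) where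

    private
      c = foot Q
      d = head Q
      q = body Q

    -- The ear replaces the stretch of arc i between its ends.
    detour-through : ∀ i (p : Path (src θ) c) (r : Path d (tgt θ)) → c ≢ src θ ⊎ d ≢ tgt θ →
      (∀ {v} → v ∈ᵖ p → v ∈ᵖ arc θ i) → (∀ {v} → v ∈ᵖ r → v ∈ᵖ arc θ i) →
      (∀ {u w} → Edge p u w → Edge (arc θ i) u w) → (∀ {u w} → Edge r u w → Edge (arc θ i) u w) →
      (∀ {v} → v ∈ᵖ p → v ∈ᵖ r → ⊥) → Detour θ Q
    detour-through i p r ne p∈ r∈ pE rE apart = result ne
      where
      J₁ = join p q (λ a b → [ (λ e → e) , (λ { refl → ⊥-elim (apart a (start∈ (trail r))) }) ]′ (inner Q b (i , p∈ a)))
      module J₁ = Join (proj₂ J₁)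
      J₂ = join (proj₁ J₁) r (λ a b → [ (λ a' → ⊥-elim (apart a' b))
             , (λ a' → [ (λ { refl → ⊥-elim (apart (end∈ (trail p)) b) }) , (λ e → e) ]′ (inner Q a' (i , r∈ b))) ]′ (J₁.∈⁻ a))
      module J₂ = Join (proj₂ J₂)
      s = proj₁ J₂
      s∈ : ∀ {v} → v ∈ᵖ s → v ∈ᵖ arc θ i ⊎ v ∈ᵖ q
      s∈ a = [ (λ b → Sum.map₁ p∈ (J₁.∈⁻ b)) , inj₁ ∘ r∈ ]′ (J₂.∈⁻ a)
      sE : ∀ {u w} → Edge s u w → Edge (arc θ i) u w ⊎ Edge q u w
      sE a = [ (λ b → Sum.map₁ pE (J₁.edge⁻ b)) , inj₁ ∘ rE ]′ (J₂.edge⁻ a)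
      s-inner : ∀ {v} → v ∈ᵖ s → ΘV (removeArc θ i) v → v ≡ src θ ⊎ v ≡ tgt θ
      s-inner {v} a (j , b) = meet θ (punchInᵢ≢i i j ∘ sym) ([ (λ z → z) , on-q ]′ (s∈ a)) b
        where
        on-q : v ∈ᵖ q → v ∈ᵖ arc θ i
        on-q z = [ (λ { refl → p∈ (end∈ (trail p)) }) , (λ { refl → r∈ (start∈ (trail r)) }) ]′ (inner Q z (_ , b))
      θ' : Θ 3
      θ' = addArc (removeArc θ i) s s-inner
        (λ e (j , f) → [ (λ e' → arcs-edge-disjoint θ (punchInᵢ≢i i j ∘ sym) e' f) , (λ e' → fresh Q e' (_ , f)) ]′ (sE e))
        (λ e → [ arc-adj θ , body-adj Q ]′ (sE e))
      within' : ∀ {u w} → ΘE θ' u w → ΘE θ u w ⊎ Edge q u w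
      within' (zero  , e) = Sum.map₁ (i ,_) (sE e)
      within' (suc j , e) = inj₁ (_ , e)
      qe = proj₂ (firstEdge q (foot≢head Q))
      -- The shared edge is taken from an outer stretch of arc `i` that is nontrivial; it lies on
      -- the rerouted arc `s` together with the ear.
      result : c ≢ src θ ⊎ d ≢ tgt θ → Detour θ Q
      result (inj₁ ne) = let _ , e = firstEdge p (ne ∘ sym) in record
        { other = θ' ; shared = pE e ; j = zero ; shared' = J₂.edgeˡ (J₁.edgeˡ e)
        ; earEdge = qe ; earEdge' = J₂.edgeˡ (J₁.edgeʳ qe) ; within = within' }
      result (inj₂ ne) = let _ , e = firstEdge r ne in record
        { other = θ' ; shared = rE e ; j = zero ; shared' = J₂.edgeʳ e
        ; earEdge = qe ; earEdge' = J₂.edgeˡ (J₁.edgeʳ qe) ; within = within' }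

    -- The ear joins the interiors of arcs i and j: θ ∪ Q is a subdivision of K₄,
    -- which also contains a theta graph with branch vertices src θ and head Q.
    detour-across : ∀ {i j k} → i ≢ j → k ≢ i → k ≢ j → c ∈ᵖ arc θ i → d ∈ᵖ arc θ j →
      ¬ c ∈ᵖ arc θ j → ¬ d ∈ᵖ arc θ i → Detour θ Q
    detour-across {i} {j} {k} i≢j k≢i k≢j c∈i d∈j c∉j d∉i
      with split (arc θ i) c∈i | split (arc θ j) d∈j
    ... | p₁ , p₂ , jp | r₁ , r₂ , jr = record
      { other = θ₃ ; shared = P.edgeˡ (proj₂ pe) ; j = zero ; shared' = J₀.edgeˡ (proj₂ pe)
      ; earEdge = proj₂ qe ; earEdge' = J₀.edgeʳ (proj₂ qe) ; within = within' }
      where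
      module P = Join jp
      module R = Join jr
      src∈ : ∀ l → src θ ∈ᵖ arc θ l
      src∈ l = start∈ (trail (arc θ l))
      tgt∈ : ∀ l → tgt θ ∈ᵖ arc θ l
      tgt∈ l = end∈ (trail (arc θ l))
      c≢src : c ≢ src θ
      c≢src refl = c∉j (src∈ j)
      c≢tgt : c ≢ tgt θ
      c≢tgt refl = c∉j (tgt∈ j)
      d≢src : d ≢ src θ
      d≢src refl = d∉i (src∈ i)
      tgt∉p₁ : ¬ tgt θ ∈ᵖ p₁
      tgt∉p₁ a = c≢tgt (sym (P.meet a (end∈ (trail p₂))))
      tgt∉r₁ : ¬ tgt θ ∈ᵖ r₁
      tgt∉r₁ a = d∉i (subst (_∈ᵖ arc θ i) (R.meet a (end∈ (trail r₂))) (tgt∈ i))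
      src∉r₂ : ¬ src θ ∈ᵖ r₂
      src∉r₂ a = d≢src (sym (R.meet (start∈ (trail r₁)) a))
      r₂⁻ = rev r₂
      module S = Same (proj₂ r₂⁻)
      J₀ = join p₁ q (λ a b → [ (λ e → e) , (λ { refl → ⊥-elim (d∉i (P.∈ˡ a)) }) ]′ (inner Q b (i , P.∈ˡ a)))
      module J₀ = Join (proj₂ J₀)
      J₂ = join (arc θ k) (proj₁ r₂⁻) (λ a b → [ (λ { refl → ⊥-elim (src∉r₂ (S.∈⇐ b)) }) , (λ e → e) ]′
             (meet θ k≢j a (R.∈ʳ (S.∈⇐ b))))
      module J₂ = Join (proj₂ J₂)
      -- The arcs from `src θ` to `d` are arc `k` followed by `r₂` reversed, the stretch `r₁`, and
      -- `p₁` followed by the ear. Only the stretch `p₂` of arc `i` is given up.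
      θ₁ θ₂ θ₃ : Θ _
      θ₁ = addArc (noArcs (d≢src ∘ sym)) (proj₁ J₂) (λ { _ (() , _) }) (λ { _ (() , _) })
        (λ e → [ arc-adj θ , (λ f → arc-adj θ (R.edgeʳ (S.edge⇐ f))) ]′ (J₂.edge⁻ e))
      θ₂ = addArc θ₁ r₁ in₂ fr₂ (λ e → arc-adj θ (R.edgeˡ e))
        where
        in₂ : ∀ {v} → v ∈ᵖ r₁ → ΘV θ₁ v → v ≡ src θ ⊎ v ≡ d
        in₂ a (zero , b) with J₂.∈⁻ b
        ... | inj₂ b' = inj₂ (R.meet a (S.∈⇐ b'))
        ... | inj₁ b' with meet θ k≢j b' (R.∈ˡ a)
        ...   | inj₁ e    = inj₁ e
        ...   | inj₂ refl = ⊥-elim (tgt∉r₁ a)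
        fr₂ : ∀ {u w} → Edge r₁ u w → ¬ ΘE θ₁ u w
        fr₂ e (zero , f) with J₂.edge⁻ f
        ... | inj₁ f' = arcs-edge-disjoint θ k≢j f' (R.edgeˡ e)
        ... | inj₂ f' = path-≢ r₁ e (trans (R.meet (proj₁ (edge-ends r₁ e)) (proj₁ (edge-ends r₂ (S.edge⇐ f'))))
                                      (sym (R.meet (proj₂ (edge-ends r₁ e)) (proj₂ (edge-ends r₂ (S.edge⇐ f'))))))
      θ₃ = addArc θ₂ (proj₁ J₀) (λ a → in₃ (J₀.∈⁻ a)) (λ e → fr₃ (J₀.edge⁻ e))
        (λ e → [ (λ f → arc-adj θ (P.edgeˡ f)) , body-adj Q ]′ (J₀.edge⁻ e))
        where
        of-θ₂ : ∀ {v} → ΘV θ₂ v → v ∈ᵖ arc θ j ⊎ v ∈ᵖ arc θ k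
        of-θ₂ (zero , b)     = inj₁ (R.∈ˡ b)
        of-θ₂ (suc zero , b) = [ inj₂ , (λ b' → inj₁ (R.∈ʳ (S.∈⇐ b'))) ]′ (J₂.∈⁻ b)
        in₃ : ∀ {v} → v ∈ᵖ p₁ ⊎ v ∈ᵖ q → ΘV θ₂ v → v ≡ src θ ⊎ v ≡ d
        in₃ (inj₁ a) b with [ meet θ i≢j (P.∈ˡ a) , meet θ (k≢i ∘ sym) (P.∈ˡ a) ]′ (of-θ₂ b)
        ... | inj₁ e    = inj₁ e
        ... | inj₂ refl = ⊥-elim (tgt∉p₁ a)
        in₃ (inj₂ a) b with inner Q a ([ (_ ,_) , (_ ,_) ]′ (of-θ₂ b))
        ... | inj₂ e    = inj₂ e
        ... | inj₁ refl with of-θ₂ b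
        ...   | inj₁ b' = ⊥-elim (c∉j b')
        ...   | inj₂ b' = ⊥-elim ([ c≢src , c≢tgt ]′ (meet θ k≢i b' c∈i))
        fr₃ : ∀ {u w} → Edge p₁ u w ⊎ Edge q u w → ¬ ΘE θ₂ u w
        fr₃ e (zero , f) = [ (λ e' → arcs-edge-disjoint θ i≢j (P.edgeˡ e') (R.edgeˡ f)) , (λ e' → fresh Q e' (_ , R.edgeˡ f)) ]′ e
        fr₃ e (suc zero , f) with J₂.edge⁻ f
        ... | inj₁ f' = [ (λ e' → arcs-edge-disjoint θ k≢i f' (P.edgeˡ e')) , (λ e' → fresh Q e' (_ , f')) ]′ e
        ... | inj₂ f' = [ (λ e' → arcs-edge-disjoint θ i≢j (P.edgeˡ e') (R.edgeʳ (S.edge⇐ f')))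
                        , (λ e' → fresh Q e' (_ , R.edgeʳ (S.edge⇐ f'))) ]′ e
      pe = firstEdge p₁ (c≢src ∘ sym)
      qe = firstEdge q (foot≢head Q)
      within' : ∀ {u w} → ΘE θ₃ u w → ΘE θ u w ⊎ Edge q u w
      within' (zero , e)           = Sum.map₁ (λ f → i , P.edgeˡ f) (J₀.edge⁻ e)
      within' (suc zero , e)       = inj₁ (j , R.edgeˡ e)
      within' (suc (suc zero) , e) = inj₁ ([ (k ,_) , (λ f → j , R.edgeʳ (S.edge⇐ f)) ]′ (J₂.edge⁻ e))

  detour-rev : (θ : Θ 3) (Q : EarOf (ΘV θ) (ΘE θ)) → Detour θ (revEar Q) → Detour θ Q
  detour-rev θ Q D = record
    { other = other ; shared = shared ; shared' = shared' ; earEdge = edge⇐ earEdge ; earEdge' = earEdge'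
    ; within = λ e → Sum.map₂ edge⇐ (within e) }
    where
    open Detour D
    open Same (proj₂ (rev (body Q)))

  -- The end met earlier from `src θ` closes the initial stretch; if that is the head, the ear is
  -- reversed. Since the ear does not span `θ`, one of the outer stretches has an edge.
  detour-along : (θ : Θ 3) (Q : EarOf (ΘV θ) (ΘE θ)) → ¬ Spans θ (foot Q) (head Q) →
    ∀ i → foot Q ∈ᵖ arc θ i → head Q ∈ᵖ arc θ i → Detour θ Q
  detour-along θ Q nt i c∈ d∈ with split (arc θ i) c∈
  ... | p₁ , p₂ , jp with Join.∈⁻ jp d∈
  ... | inj₂ d∈p₂ with split p₂ d∈p₂
  ...   | p₂₁ , p₂₂ , jp₂ = detour-through θ Q i p₁ p₂₂ ne P.∈ˡ (P.∈ʳ ∘ P₂.∈ʳ) P.edgeˡ (P.edgeʳ ∘ P₂.edgeʳ)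
          (λ a b → foot≢head Q (P₂.meet (start∈ (trail p₂₁)) (subst (_∈ᵖ p₂₂) (P.meet a (P₂.∈ʳ b)) b)))
    where
    module P = Join jp
    module P₂ = Join jp₂
    ne : foot Q ≢ src θ ⊎ head Q ≢ tgt θ
    ne with foot Q ≟ src θ
    ... | no h   = inj₁ h
    ... | yes eq = inj₂ (λ eq' → nt (inj₁ (eq , eq')))
  detour-along θ Q nt i c∈ d∈ | p₁ , p₂ , jp | inj₁ d∈p₁ with split p₁ d∈p₁
  ...   | p₁₁ , p₁₂ , jp₁ = detour-rev θ Q (detour-through θ (revEar Q) i p₁₁ p₂ ne (P.∈ˡ ∘ P₁.∈ˡ) P.∈ʳ (P.edgeˡ ∘ P₁.edgeˡ) P.edgeʳ
          (λ a b → foot≢head Q (P₁.meet (subst (_∈ᵖ p₁₁) (P.meet (P₁.∈ˡ a) b) a) (end∈ (trail p₁₂)))))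
    where
    module P = Join jp
    module P₁ = Join jp₁
    ne : head Q ≢ src θ ⊎ foot Q ≢ tgt θ
    ne with head Q ≟ src θ
    ... | no h   = inj₁ h
    ... | yes eq = inj₂ (λ eq' → nt (inj₂ (eq' , eq)))

  -- If neither end lies on the arc found for the other, neither is a branch vertex, because those
  -- lie on every arc; the ends are then interior to different arcs.
  detour : (θ : Θ 3) (Q : EarOf (ΘV θ) (ΘE θ)) → ¬ Spans θ (foot Q) (head Q) → Detour θ Q
  detour θ Q nt with foot∈ Q | head∈ Q
  ... | i , c∈i | j , d∈j with foot Q ∈? verts (arc θ j) | head Q ∈? verts (arc θ i)
  ...   | yes c∈j | _       = detour-along θ Q nt j c∈j d∈j
  ...   | no _    | yes d∈i = detour-along θ Q nt i c∈i d∈i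
  ...   | no c∉j  | no d∉i  = let k , k≢i , k≢j = avoid i j in
          detour-across θ Q (λ { refl → c∉j c∈i }) k≢i k≢j c∈i d∈j c∉j d∉i

  ear-family : (θ : Θ 3) (Q : EarOf (ΘV θ) (ΘE θ)) → ¬ Spans θ (foot Q) (head Q) →
    ∃ λ u → ∃ λ w → ΘE θ u w ×
    Family 4 u w (λ C → ∀ {a b} → CycEdge G C a b → ΘE θ a b ⊎ Edge (body Q) a b)
  ear-family θ Q nt = _ , _ , (_ , shared) , record
    { cycle = F.cycle ; through = F.through ; distinct = F.distinct
    ; property = λ i e → [ (λ h → inj₁ (proj₁ h e)) , (λ h → within (proj₁ h e)) ]′ (F.property i) }
    where
    open Detour (detour θ Q nt)
    F = append (Θ-family θ i shared) (Θ-family other j shared')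
      (λ P R same → fresh Q earEdge (proj₁ P (Equivalence.from (same _ _) (proj₂ R earEdge'))))
    module F = Family F

  -- Ears in 2-connected subgraphs

  edge? : ∀ ps (u w : Fin n) → Dec (EdgeIn ps u w)
  edge? ps u w = ((u , w) ∈²? ps) ⊎-dec ((w , u) ∈²? ps)

  -- By `edge-trivial` the path is the single edge. This detects an excursion that returns at once.
  edge-only : ∀ {a b z : Fin n} (p : Path a b) → a ≢ b → Edge p a b → Edge p a z → z ≡ b
  edge-only p a≢b e f with interior p a≢b
  ... | m , eq with edge-trivial m (subst Unique eq (simple p)) (edge-resp (cong pairs eq) e)
  ...   | refl with edge-∷⁻ (edge-resp (cong pairs eq) f)
  ...     | inj₁ (inj₁ (_ , z≡b)) = z≡b
  ...     | inj₁ (inj₂ (a≡b , _)) = ⊥-elim (a≢b a≡b)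
  ...     | inj₂ (inj₁ ())
  ...     | inj₂ (inj₂ ())

  adj-irrefl : ∀ {u w} → Adj G u w → u ≢ w
  adj-irrefl {u} a refl = subst T (Graph.irrefl G u) a

  -- Simple paths extracted from walks, and decidable reachability

  module _ {E : Fin n → Fin n → Bool} (E-sym : ∀ {u w} → T (E u w) → T (E w u)) where

    -- The part of a walk up to its first vertex in S, made simple by cutting out loops.
    firstHit : ∀ {S : Fin n → Set} (S? : ∀ v → Dec (S v)) {z f} → Reach G E z f → S f →
      ∃ λ b → Σ (Path z b) λ p → S b × (∀ {v} → v ∈ᵖ p → S v → v ≡ b) × (∀ {u w} → Edge p u w → T (E u w))
    firstHit S? {z} here Sz = z , path stop ([] ∷ []) , Sz , (λ { (here eq) _ → eq }) , λ { (inj₁ ()) ; (inj₂ ()) }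
    firstHit S? {z} (step {w = w} e r) Sf with S? z
    ... | yes Sz = z , path stop ([] ∷ []) , Sz , (λ { (here eq) _ → eq }) , λ { (inj₁ ()) ; (inj₂ ()) }
    ... | no ¬Sz with firstHit S? r Sf
    ...   | b , p@(path t ul) , Sb , first , pE with z ∈? verts p
    ...     | yes z∈ = let _ , r , j = split p z∈ in
              b , r , Sb , (λ i → first (Join.∈ʳ j i)) , λ e → pE (Join.edgeʳ j e)
    ...     | no z∉  = b , path (go t) (∷-unique z∉ ul) , Sb
              , (λ { (here refl) Sz → ⊥-elim (¬Sz Sz) ; (there i) → first i })
              , λ e' → [ (λ { (inj₁ (refl , refl)) → e ; (inj₂ (refl , refl)) → E-sym e }) , pE ]′
                         (edge-∷⁻ (edge-resp (pairs-trail t) e'))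

    -- Bounding the number of steps makes reachability decidable by recursion; the bound `n`
    -- suffices because a simple path has at most `n` vertices.
    Within : ℕ → Fin n → Fin n → Set
    Within zero    u v = u ≡ v
    Within (suc k) u v = u ≡ v ⊎ ∃ λ w → T (E u w) × Within k w v

    within? : ∀ k u v → Dec (Within k u v)
    within? zero    u v = u ≟ v
    within? (suc k) u v = (u ≟ v) ⊎-dec any? (λ w → T? (E u w) ×-dec within? k w v)

    within⇒reach : ∀ k {u v} → Within k u v → Reach G E u v
    within⇒reach zero    refl               = here
    within⇒reach (suc k) (inj₁ refl)        = here
    within⇒reach (suc k) (inj₂ (w , e , r)) = step e (within⇒reach k r)

    trail⇒within : ∀ k {u l v} → Trail u l v → length l ≤ suc k →
      (∀ {a b} → EdgeIn (pairs l) a b → T (E a b)) → Within k u v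
    trail⇒within zero    stop        len h = refl
    trail⇒within zero    (go stop)   (s≤s ()) h
    trail⇒within zero    (go (go _)) (s≤s ()) h
    trail⇒within (suc k) stop        len h = inj₁ refl
    trail⇒within (suc k) (go t)      (s≤s len) h = inj₂ (_ , h (edge-resp (sym (pairs-trail t)) (inj₁ (here refl)))
      , trail⇒within k t len (λ e → h (edge-resp (sym (pairs-trail t)) (edge-there e))))

    reach⇒within : ∀ {u v} → Reach G E u v → Within n u v
    reach⇒within {u} {v} r with firstHit (_≟ v) r refl
    ... | _ , path t ul , refl , _ , pE =
      trail⇒within n t (≤-trans (injective⇒≤ (λ {i} {j} → lookup-injective ul i j)) (n≤1+n n)) pE

    -- `¬ CutVertex` gives connectedness after a deletion only doubly negated; deciding reachability
    -- turns it into actual walks.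
    reach? : ∀ u v → Dec (Reach G E u v)
    reach? u v = map′ (within⇒reach n) reach⇒within (within? n u v)

  reach-trans : ∀ {E u v w} → Reach G E u v → Reach G E v w → Reach G E u w
  reach-trans here       s = s
  reach-trans (step e r) s = step e (reach-trans r s)

  delV⁺ : ∀ {V x v} → T (V v) → v ≢ x → T (delV G V x v)
  delV⁺ {V} {x} {v} h ne with V v | v ≟ x
  ... | true | no _  = tt
  ... | _    | yes e = ⊥-elim (ne e)

  delV⁻ : ∀ {V x v} → T (delV G V x v) → T (V v) × v ≢ x
  delV⁻ {V} {x} {v} h with V v | v ≟ x
  ... | true | no ne = tt , ne

  delE⁺ : ∀ {E x u v} → T (E u v) → u ≢ x → v ≢ x → T (delE G E x u v)
  delE⁺ {E} {x} {u} {v} h nu nv with E u v | u ≟ x | v ≟ x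
  ... | true | no _  | no _  = tt
  ... | _    | yes e | _     = ⊥-elim (nu e)
  ... | _    | _     | yes e = ⊥-elim (nv e)

  delE⁻ : ∀ {E x u v} → T (delE G E x u v) → T (E u v) × u ≢ x × v ≢ x
  delE⁻ {E} {x} {u} {v} h with E u v | u ≟ x | v ≟ x
  ... | true | no nu | no nv = tt , nu , nv

  E-swap : (H : Subgraph G) → ∀ {u w} → T (E H u w) → T (E H w u)
  E-swap H {u} {w} = subst T (E-sym H u w)

  E-right : (H : Subgraph G) → ∀ {u w} → T (E H u w) → T (V H w)
  E-right H e = E-ends H _ _ (E-swap H e)

  -- Exactly the condition under which blocks are maximal, so a single vertex and a single edge also
  -- qualify.
  TwoConnected : Subgraph G → Set
  TwoConnected H = SubConnected G H × (∀ x → ¬ CutVertex G H x)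

  module _ (H : Subgraph G) (2c : TwoConnected H) where

    reach-avoiding : ∀ {x u v} → T (V H x) → T (V H u) → u ≢ x → T (V H v) → v ≢ x → Reach G (delE G (E H) x) u v
    reach-avoiding {x} {u} {v} x∈ u∈ u≢x v∈ v≢x = decidable-stable
      (reach? (λ e → let a , b , c = delE⁻ {E H} e in delE⁺ {E H} (E-swap H a) c b) u v)
      (λ nr → proj₂ 2c x (x∈ , λ conn → nr (conn u v (delV⁺ {V H} u∈ u≢x) (delV⁺ {V H} v∈ v≢x))))

    record Excursion (S : Fin n → Set) (a z : Fin n) : Set where
      field
        {b}     : Fin n
        a≢b     : a ≢ b
        b∈      : S b
        route   : Path a b
        away    : ∀ {v} → v ∈ᵖ route → S v → v ≡ a ⊎ v ≡ b
        first   : Edge route a z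
        route-E : ∀ {u w} → Edge route u w → T (E H u w)

    -- With `a` deleted, `z` still reaches `f`. The walk is cut at its first vertex in `S`, and the
    -- edge `az` is put in front; `f` ensures that `S` is met away from `a`.
    excursion : ∀ {S : Fin n → Set} (S? : ∀ v → Dec (S v)) {a z f} → T (E H a z) → S f → T (V H f) → f ≢ a → Excursion S a z
    excursion S? {a} {z} {f} e Sf f∈ f≢a
      with firstHit (λ e → let x , y , w = delE⁻ {E H} e in delE⁺ {E H} (E-swap H x) w y) S?
             (reach-avoiding (E-ends H _ _ e) (E-right H e) (adj-irrefl (E⊆adj H _ _ e) ∘ sym) f∈ f≢a) Sf
    ... | b , p@(path t ul) , Sb , only , pE = record
      { a≢b = λ { refl → a∉ (end∈ t) } ; b∈ = Sb ; route = path (go t) (∷-unique a∉ ul)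
      ; away = λ { (here eq) _ → inj₁ eq ; (there i) Sv → inj₂ (only i Sv) }
      ; first = edge-resp (sym (pairs-trail t)) (inj₁ (here refl))
      ; route-E = λ e' → [ (λ { (inj₁ (refl , refl)) → e ; (inj₂ (refl , refl)) → E-swap H e })
                         , (λ e'' → proj₁ (delE⁻ {E H} (pE e''))) ]′ (edge-∷⁻ (edge-resp (pairs-trail t) e')) }
      where
      a∉ : a ∉ verts p
      a∉ i with start-or-edge t i
      ... | inj₁ eq       = adj-irrefl (E⊆adj H _ _ e) eq
      ... | inj₂ (_ , e') = proj₁ (proj₂ (delE⁻ {E H} (pE e'))) refl

    module _ {FV : Fin n → Set} {FE : Fin n → Fin n → Set}
             (FV? : ∀ v → Dec (FV v)) (FE? : ∀ u w → Dec (FE u w))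
             (FE-ends : ∀ {u w} → FE u w → FV u × FV w) where

      Covers : Set
      Covers = (∀ {v} → T (V H v) → FV v) × (∀ {u w} → T (E H u w) → FE u w)

      -- If no edge of `H` at a vertex of F lies outside F, membership in F spreads from `f` along
      -- walks to all of `H`.
      exitEdge : ∀ {f} → FV f → T (V H f) →
        Covers ⊎ ∃ λ a → ∃ λ z → T (E H a z) × FV a × ¬ FE a z
      exitEdge {f} Ff f∈ with any? (λ a → any? (λ z → T? (E H a z) ×-dec FV? a ×-dec ¬? (FE? a z)))
      ... | yes ex = inj₂ ex
      ... | no ¬ex = inj₁ (cover , λ e → stay e (cover (E-ends H _ _ e)))
        where
        stay : ∀ {u w} → T (E H u w) → FV u → FE u w
        stay {u} {w} e Fu = decidable-stable (FE? u w) (λ ¬F → ¬ex (u , w , e , Fu , ¬F))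
        along : ∀ {u v} → Reach G (E H) u v → FV u → FV v
        along here       Fu = Fu
        along (step e r) Fu = along r (proj₂ (FE-ends (stay e Fu)))
        cover : ∀ {v} → T (V H v) → FV v
        cover v∈ = along (proj₁ 2c _ _ f∈ v∈) Ff

      module _ (FE-sym : ∀ {u w} → FE u w → FE w u) where

        -- An excursion along an exit edge at `a` needs a vertex of F other than `a` to return to;
        -- of two distinct vertices one will do.
        properEar : ∀ {f f'} → f ≢ f' → FV f → T (V H f) → FV f' → T (V H f') →
          Covers ⊎ Σ (EarOf FV FE) λ Q → ∀ {u w} → Edge (EarOf.body Q) u w → T (E H u w)
        properEar {f} {f'} f≢f' Ff f∈ Ff' f'∈ with exitEdge Ff f∈
        ... | inj₁ c = inj₁ c
        ... | inj₂ (a , z , e , Fa , ¬Faz) = inj₂ (ear (target (f ≟ a)))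
          where
          target : Dec (f ≡ a) → Excursion FV a z
          target (no f≢a)   = excursion FV? e Ff f∈ f≢a
          target (yes refl) = excursion FV? e Ff' f'∈ (f≢f' ∘ sym)
          ear : Excursion FV a z → Σ (EarOf FV FE) λ Q → ∀ {u w} → Edge (EarOf.body Q) u w → T (E H u w)
          ear X = record
            { foot≢head = a≢b ; foot∈ = Fa ; head∈ = b∈ ; body = route ; inner = away
            ; fresh = notF ; body-adj = λ e' → E⊆adj H _ _ (route-E e') } , route-E
            where
            open Excursion X
            -- A route edge in F has both ends among `a` and `b`. If it is `ab`, the route is the
            -- single edge `az`, chosen outside F.
            notF' : Edge route a b → ¬ FE a b
            notF' e' with edge-only route a≢b e' first
            ... | refl = ¬Faz
            notF : ∀ {u w} → Edge route u w → ¬ FE u w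
            notF e' F with away (proj₁ (edge-ends route e')) (proj₁ (FE-ends F))
                         | away (proj₂ (edge-ends route e')) (proj₂ (FE-ends F))
            ... | inj₁ refl | inj₁ refl = path-≢ route e' refl
            ... | inj₁ refl | inj₂ refl = notF' e' F
            ... | inj₂ refl | inj₁ refl = notF' (edge-sym e') (FE-sym F)
            ... | inj₂ refl | inj₂ refl = path-≢ route e' refl

    -- An ear of C starting with vv', closed up by the arc of C that contains uw.
    cycle-extend : ∀ {u w v v'} (C : Cycle G) → CycEdge G C u w → T (V H u) → T (V H w) →
      v ∈ cverts C → T (E H v v') → Σ (Cycle G) λ C' → CycEdge G C' u w × CycEdge G C' v v'
    cycle-extend {u} {w} {v} {v'} C e u∈ w∈ v∈ f with edge? (cpairs (cverts C)) v v'
    ... | yes g = C , e , g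
    ... | no ¬g with target (u ≟ v)
      where
      target : Dec (u ≡ v) → Excursion (_∈ cverts C) v v'
      target (no u≢v)   = excursion (_∈? cverts C) f (proj₁ (cycle-edge-ends C e)) u∈ u≢v
      target (yes refl) = excursion (_∈? cverts C) f (proj₂ (cycle-edge-ends C e)) w∈ (adj-irrefl (cycle-adj C e) ∘ sym)
    ... | X with cycle-arcs C v∈ (Excursion.b∈ X) (Excursion.a≢b X)
    ...   | p , q , A = [ via A , via (arcs-swap A) ]′ (Arcs.edge⁻ A e)
      where
      open Excursion X
      adjacent : ∀ {u w} → Edge route u w → Adj G u w
      adjacent g = E⊆adj H _ _ (route-E g)
      via : ∀ {p q} → Arcs C p q → Edge p u w → Σ (Cycle G) λ C' → CycEdge G C' u w × CycEdge G C' v v'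
      via {p} A e' =
        let C' , A' = mkCycle p route a≢b (λ i j → away j (Arcs.∈ˡ A i)) twin (λ g → cycle-adj C (Arcs.edgeˡ A g)) adjacent
        in C' , Arcs.edgeˡ A' e' , Arcs.edgeʳ A' first
        where
        -- Here the route would be one edge, so that `b` is `v'` and `vv'` already lies on `C`.
        twin : Edge p v b → Edge route v b → ⊥
        twin g h with edge-only route a≢b h first
        ... | refl = ¬g (Arcs.edgeˡ A g)

    -- Invariant of the walk from `u` to `c`: the current cycle contains `uw` and the current
    -- vertex. Each step absorbs the edge walked, the last one absorbs `cd`.
    commonCycle : ∀ {u w c d} (C : Cycle G) → CycEdge G C u w → T (E H u w) → T (E H c d) →
      Σ (Cycle G) λ C' → CycEdge G C' u w × CycEdge G C' c d
    commonCycle {u} {w} {c} {d} C e eH f = walk C e (proj₁ (cycle-edge-ends C e)) (proj₁ 2c u c u∈ (E-ends H _ _ f))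
      where
      u∈ = E-ends H _ _ eH
      w∈ = E-right H eH
      walk : ∀ {v} (C : Cycle G) → CycEdge G C u w → v ∈ cverts C → Reach G (E H) v c →
        Σ (Cycle G) λ C' → CycEdge G C' u w × CycEdge G C' c d
      walk C e v∈ here       = cycle-extend C e u∈ w∈ v∈ f
      walk C e v∈ (step g r) =
        let C' , e' , g' = cycle-extend C e u∈ w∈ v∈ g in walk C' e' (proj₂ (cycle-edge-ends C' g')) r

    family-grow : ∀ {m u w c d P} → Family (suc m) u w P → (∀ {C} → P C → ¬ CycEdge G C c d) →
      T (E H u w) → T (E H c d) → Family (suc (suc m)) u w (λ _ → ⊤)
    family-grow {m} {u} {w} {c} {d} {P} F avoids e f =
      let C , eC , fC = commonCycle (Family.cycle F zero) (Family.through F zero) e f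
          one : Family 1 u w (λ C → CycEdge G C c d)
          one = record { cycle = λ _ → C ; through = λ _ → eC ; distinct = λ { {zero} {zero} ne → ⊥-elim (ne refl) } ; property = λ _ → fC }
          F' = append one F (λ fC PD same → avoids PD (Equivalence.to (same c d) fC))
      in record { cycle = Family.cycle F' ; through = Family.through F' ; distinct = Family.distinct F' ; property = λ _ → tt }

  -- Blocks of a k-cactus

  does⁺ : ∀ {P : Set} (d : Dec P) → P → T (does d)
  does⁺ (yes _) _ = tt
  does⁺ (no ¬p) p = ¬p p

  does⁻ : ∀ {P : Set} (d : Dec P) → T (does d) → P
  does⁻ (yes p) _ = p

  T-ext : ∀ {a b} → (T a → T b) → (T b → T a) → a ≡ b
  T-ext {true}  {true}  f g = refl
  T-ext {false} {false} f g = refl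
  T-ext {true}  {false} f g = ⊥-elim (f tt)
  T-ext {false} {true}  f g = ⊥-elim (g tt)

  subgraphOf : {FV : Fin n → Set} {FE : Fin n → Fin n → Set} → (∀ v → Dec (FV v)) → (∀ u w → Dec (FE u w)) →
    (∀ {u w} → FE u w → FE w u) → (∀ {u w} → FE u w → Adj G u w) → (∀ {u w} → FE u w → FV u) → Subgraph G
  subgraphOf FV? FE? FE-sym FE-adj FE-ends = record
    { V = λ v → does (FV? v)
    ; E = λ u w → does (FE? u w)
    ; E-sym = λ u w → T-ext (λ e → does⁺ (FE? w u) (FE-sym (does⁻ (FE? u w) e))) (λ e → does⁺ (FE? u w) (FE-sym (does⁻ (FE? w u) e)))
    ; E⊆adj = λ u w e → FE-adj (does⁻ (FE? u w) e)
    ; E-ends = λ u w e → does⁺ (FV? u) (FE-ends (does⁻ (FE? u w) e)) }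

  module _ {x y : Fin n} (xy : Adj G x y) where
    EdgeV : Fin n → Set
    EdgeV v = v ≡ x ⊎ v ≡ y

    EdgeE : Fin n → Fin n → Set
    EdgeE a b = (a ≡ x × b ≡ y) ⊎ (a ≡ y × b ≡ x)

    edgeV? : ∀ v → Dec (EdgeV v)
    edgeV? v = (v ≟ x) ⊎-dec (v ≟ y)

    edgeE? : ∀ a b → Dec (EdgeE a b)
    edgeE? a b = ((a ≟ x) ×-dec (b ≟ y)) ⊎-dec ((a ≟ y) ×-dec (b ≟ x))

    edgeE-sym : ∀ {a b} → EdgeE a b → EdgeE b a
    edgeE-sym (inj₁ (p , q)) = inj₂ (q , p)
    edgeE-sym (inj₂ (p , q)) = inj₁ (q , p)

    edgeE-ends : ∀ {a b} → EdgeE a b → EdgeV a × EdgeV b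
    edgeE-ends (inj₁ (p , q)) = inj₁ p , inj₂ q
    edgeE-ends (inj₂ (p , q)) = inj₂ p , inj₁ q

    edgeGraph : Subgraph G
    edgeGraph = subgraphOf edgeV? edgeE? edgeE-sym
      (λ { (inj₁ (refl , refl)) → xy ; (inj₂ (refl , refl)) → adj-sym xy }) (proj₁ ∘ edgeE-ends)

    edgeGraph-2c : TwoConnected edgeGraph
    edgeGraph-2c = (λ u v u∈ v∈ → conn (does⁻ (edgeV? u) u∈) (does⁻ (edgeV? v) v∈)) ,
      λ z (z∈ , cut) → cut λ u v u∈ v∈ →
        let u∈' , u≢z = delV⁻ {V edgeGraph} u∈ ; v∈' , v≢z = delV⁻ {V edgeGraph} v∈ in
        subst (Reach G _ u) (only (does⁻ (edgeV? z) z∈) (does⁻ (edgeV? u) u∈') u≢z (does⁻ (edgeV? v) v∈') v≢z) here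
      where
      conn : ∀ {u v} → EdgeV u → EdgeV v → Reach G (E edgeGraph) u v
      conn (inj₁ refl) (inj₁ refl) = here
      conn (inj₁ refl) (inj₂ refl) = step (does⁺ (edgeE? x y) (inj₁ (refl , refl))) here
      conn (inj₂ refl) (inj₁ refl) = step (does⁺ (edgeE? y x) (inj₂ (refl , refl))) here
      conn (inj₂ refl) (inj₂ refl) = here
      only : ∀ {u v z} → EdgeV z → EdgeV u → u ≢ z → EdgeV v → v ≢ z → u ≡ v
      only _           (inj₁ refl) _ (inj₁ refl) _ = refl
      only _           (inj₂ refl) _ (inj₂ refl) _ = refl
      only (inj₁ refl) (inj₁ refl) h (inj₂ refl) _ = ⊥-elim (h refl)
      only (inj₂ refl) (inj₁ refl) _ (inj₂ refl) h = ⊥-elim (h refl)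
      only (inj₁ refl) (inj₂ refl) _ (inj₁ refl) h = ⊥-elim (h refl)
      only (inj₂ refl) (inj₂ refl) h (inj₁ refl) _ = ⊥-elim (h refl)

  otherVertex : ∀ {m} → 2 ≤ m → (x : Fin m) → ∃ λ y → x ≢ y
  otherVertex (s≤s (s≤s _)) zero    = suc zero , λ ()
  otherVertex (s≤s (s≤s _)) (suc x) = zero , λ ()

  anyVertex : ∀ {m} → 2 ≤ m → Fin m
  anyVertex (s≤s _) = zero

  -- A connected subgraph without edges has at most one vertex. As `G` is connected with at least
  -- two vertices, that vertex has an incident edge, whose edge graph contradicts maximality.
  block-edge : 2 ≤ n → Connected G → ∀ B → IsBlock G B → ∃ λ u → ∃ λ w → T (E B u w)
  block-edge 2≤n conn B (Bc , _ , Bmax) with any? (λ u → any? (λ w → T? (E B u w)))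
  ... | yes ex = ex
  ... | no ¬ex = ⊥-elim (¬ex (x , y , proj₂ (Bmax (edgeGraph xy) (V⊆ , λ u w e → ⊥-elim (¬ex (u , w , e)))
                   (proj₁ (edgeGraph-2c xy)) (proj₂ (edgeGraph-2c xy))) x y (does⁺ (edgeE? xy x y) (inj₁ (refl , refl)))))
    where
    trivial : ∀ {u v} → Reach G (E B) u v → u ≡ v
    trivial here       = refl
    trivial (step e _) = ⊥-elim (¬ex (_ , _ , e))
    centre : ∃ λ x → ∀ v → T (V B v) → v ≡ x
    centre with any? (λ v → T? (V B v))
    ... | yes (x , x∈) = x , λ v v∈ → trivial (Bc v x v∈ x∈)
    -- The empty subgraph is enlarged at an arbitrary vertex of `G`.
    ... | no none      = anyVertex 2≤n , λ v v∈ → ⊥-elim (none (v , v∈))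
    x = proj₁ centre
    neighbour : ∀ {x z} → Reach G adj x z → x ≢ z → ∃ λ y → Adj G x y
    neighbour here       x≢z = ⊥-elim (x≢z refl)
    neighbour (step e _) _   = _ , e
    nb : ∃ λ y → Adj G x y
    nb = let z , x≢z = otherVertex 2≤n x in neighbour (conn x z tt tt) x≢z
    y = proj₁ nb
    xy = proj₂ nb
    V⊆ : ∀ v → T (V B v) → T (V (edgeGraph xy) v)
    V⊆ v v∈ = does⁺ (edgeV? xy v) (inj₁ (proj₂ centre v v∈))

  ΘV? : (θ : Θ t) → ∀ v → Dec (ΘV θ v)
  ΘV? θ v = any? (λ i → v ∈? verts (arc θ i))

  ΘE? : (θ : Θ t) → ∀ u w → Dec (ΘE θ u w)
  ΘE? θ u w = any? (λ i → edge? (pairs (verts (arc θ i))) u w)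

  ΘE-ends : (θ : Θ t) → ∀ {u w} → ΘE θ u w → ΘV θ u × ΘV θ w
  ΘE-ends θ (i , e) = let a , b = edge-ends (arc θ i) e in (i , a) , (i , b)

  ΘE-sym : (θ : Θ t) → ∀ {u w} → ΘE θ u w → ΘE θ w u
  ΘE-sym θ (i , e) = i , edge-sym e

  spans? : (θ : Θ t) → ∀ c d → Dec (Spans θ c d)
  spans? θ c d = ((c ≟ src θ) ×-dec (d ≟ tgt θ)) ⊎-dec ((c ≟ tgt θ) ×-dec (d ≟ src θ))

  module _ (B : Subgraph G) (2c : TwoConnected B) where

    -- Thetas and ears are placed in `B` by their edges alone; each vertex of a nontrivial path ends
    -- one of its edges, so the vertices follow.
    path-⊆V : ∀ {x y} (p : Path x y) → x ≢ y → (∀ {u w} → Edge p u w → T (E B u w)) → ∀ {v} → v ∈ᵖ p → T (V B v)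
    path-⊆V p x≢y pE i with start-or-edge (trail p) i
    ... | inj₁ refl    = E-ends B _ _ (pE (proj₂ (firstEdge p x≢y)))
    ... | inj₂ (_ , e) = E-ends B _ _ (pE e)

    Inside : Θ t → Set
    Inside θ = ∀ {u w} → ΘE θ u w → T (E B u w)

    Θ-⊆V : (θ : Θ t) → Inside θ → ∀ {v} → ΘV θ v → T (V B v)
    Θ-⊆V θ inB (i , v∈) = path-⊆V (arc θ i) (src≢tgt θ) (λ e → inB (i , e)) v∈

    ΘCovers : Θ t → Set
    ΘCovers θ = (∀ {v} → T (V B v) → ΘV θ v) × (∀ {u w} → T (E B u w) → ΘE θ u w)

    isThetaGraph : (θ : Θ (suc t)) → Inside θ → ΘCovers θ → IsThetaGraph G (suc t) B
    isThetaGraph θ inB (cV , cE) = theta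
      , (λ v → mk⇔ (V⇒ ∘ cV) (Θ-⊆V θ inB ∘ V⇐ zero))
      , (λ a b → mk⇔ (E⇒ ∘ cE) (inB ∘ E⇐))
      where open ToTheta θ

    src∈B : (θ : Θ (suc t)) → Inside θ → ΘV θ (src θ) × T (V B (src θ))
    src∈B θ inB = let h = zero , start∈ (trail (arc θ zero)) in h , Θ-⊆V θ inB h

    tgt∈B : (θ : Θ (suc t)) → Inside θ → ΘV θ (tgt θ) × T (V B (tgt θ))
    tgt∈B θ inB = let h = zero , end∈ (trail (arc θ zero)) in h , Θ-⊆V θ inB h

    Θ-ear : (θ : Θ (suc t)) → Inside θ →
      ΘCovers θ ⊎ Σ (EarOf (ΘV θ) (ΘE θ)) λ Q → ∀ {u w} → Edge (body Q) u w → T (E B u w)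
    Θ-ear θ inB = properEar B 2c (ΘV? θ) (ΘE? θ) (ΘE-ends θ) (ΘE-sym θ) (src≢tgt θ)
      (proj₁ (src∈B θ inB)) (proj₂ (src∈B θ inB)) (proj₁ (tgt∈B θ inB)) (proj₂ (tgt∈B θ inB))

    -- The `t + 1` cycles of `Θ-family` meet the allowance exactly; an edge of `B` outside `θ` would
    -- give one more.
    Θ-maximal : (θ : Θ (suc (suc t))) → Inside θ → KCactus G (suc t) → ΘCovers θ
    Θ-maximal θ inB K with exitEdge B 2c (ΘV? θ) (ΘE? θ) (ΘE-ends θ) (proj₁ (src∈B θ inB)) (proj₂ (src∈B θ inB))
    ... | inj₁ c = c
    ... | inj₂ (a , z , e , _ , ¬θ) = ⊥-elim (family-bound
        (family-grow B 2c (Θ-family θ zero f) (λ P g → ¬θ (proj₁ P g)) (inB (zero , f)) e) K)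
      where f = next-edge θ zero

    Θ-extend : (θ : Θ t) → Inside θ → (Q : EarOf (ΘV θ) (ΘE θ)) → (∀ {u w} → Edge (body Q) u w → T (E B u w)) →
      Spans θ (foot Q) (head Q) → Σ (Θ (suc t)) Inside
    Θ-extend θ inB Q QE (inj₁ (refl , refl)) =
      addArc θ (body Q) (inner Q) (fresh Q) (body-adj Q) , λ { (zero , e) → QE e ; (suc i , e) → inB (i , e) }
    Θ-extend θ inB Q QE (inj₂ (refl , refl)) =
      addArc θ (body Q') (inner Q') (fresh Q') (body-adj Q') ,
      λ { (zero , e) → QE (Same.edge⇐ (proj₂ (rev (body Q))) e) ; (suc i , e) → inB (i , e) }
      where Q' = revEar Q

    -- An ear of a single edge has the same two ends, so both close up to a cycle; `fresh` keeps the
    -- ear from being that edge again.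
    cycle-or-edge : ∀ {u w} → T (E B u w) → IsEdgeGraph G B ⊎ Σ (Cycle G) λ C → ∀ {a b} → CycEdge G C a b → T (E B a b)
    cycle-or-edge {u} {w} e with properEar B 2c (edgeV? uw) (edgeE? uw) (edgeE-ends uw) (edgeE-sym uw)
        (adj-irrefl uw) (inj₁ refl) (E-ends B _ _ e) (inj₂ refl) (E-right B e)
      where uw = E⊆adj B _ _ e
    ... | inj₁ (cV , cE) = inj₁ (u , w , E⊆adj B _ _ e
        , (λ v → mk⇔ cV λ { (inj₁ refl) → E-ends B _ _ e ; (inj₂ refl) → E-right B e })
        , (λ a b → mk⇔ cE λ { (inj₁ (refl , refl)) → e ; (inj₂ (refl , refl)) → E-swap B e }))
    ... | inj₂ (Q , QE) = inj₂ (C , λ g → [ chordE , QE ]′ (Arcs.edge⁻ A g))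
      where
      uw = E⊆adj B _ _ e
      chord = edgePath (foot≢head Q)
      feet : EdgeE uw (foot Q) (head Q)
      feet with foot∈ Q | head∈ Q
      ... | inj₁ p | inj₂ q = inj₁ (p , q)
      ... | inj₂ p | inj₁ q = inj₂ (p , q)
      ... | inj₁ p | inj₁ q = ⊥-elim (foot≢head Q (trans p (sym q)))
      ... | inj₂ p | inj₂ q = ⊥-elim (foot≢head Q (trans p (sym q)))
      edge∈ : T (E B (foot Q) (head Q))
      edge∈ with feet
      ... | inj₁ (refl , refl) = e
      ... | inj₂ (refl , refl) = E-swap B e
      chordE : ∀ {a b} → Edge chord a b → T (E B a b)
      chordE (inj₁ (here refl)) = edge∈
      chordE (inj₂ (here refl)) = E-swap B edge∈
      CA = mkCycle chord (body Q) (foot≢head Q)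
        (λ { (here eq) _ → inj₁ eq ; (there (here eq)) _ → inj₂ eq }) (λ _ f → fresh Q f feet)
        (λ f → E⊆adj B _ _ (chordE f)) (body-adj Q)
      C = proj₁ CA
      A = proj₂ CA

    cycle-or-theta : (C : Cycle G) → (∀ {a b} → CycEdge G C a b → T (E B a b)) → IsCycleGraph G B ⊎ Σ (Θ 3) Inside
    cycle-or-theta C CE with cycle-hasEdge C
    ... | _ , _ , f with properEar B 2c (_∈? cverts C) (edge? (cpairs (cverts C))) (cycle-edge-ends C) edge-sym
        (adj-irrefl (cycle-adj C f)) (proj₁ (cycle-edge-ends C f)) (E-ends B _ _ (CE f))
        (proj₂ (cycle-edge-ends C f)) (E-right B (CE f))
    ... | inj₁ (cV , cE) = inj₁ (C
        , (λ v → mk⇔ cV (λ i → E-ends B _ _ (CE (TwoNeighbours.edgeˡ (cycle-neighbours C i)))))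
        , (λ a b → mk⇔ cE CE))
    ... | inj₂ (Q , QE) with cycle-arcs C (foot∈ Q) (head∈ Q) (foot≢head Q)
    ...   | p , q , A = inj₂ (addArc theta (body Q)
              (λ i v → inner Q i (V⇒ v)) (λ f g → fresh Q f (E⇒ g)) (body-adj Q)
            , λ { (zero , f) → QE f ; (suc i , f) → CE (E⇒ (i , f)) })
      where open ArcsTheta (foot≢head Q) A

    edge-cycle-or-theta : ∀ {u w} → T (E B u w) → IsEdgeGraph G B ⊎ IsCycleGraph G B ⊎ Σ (Θ 3) Inside
    edge-cycle-or-theta e with cycle-or-edge e
    ... | inj₁ h        = inj₁ h
    ... | inj₂ (C , CE) = inj₂ (cycle-or-theta C CE)

    theta⇒2 : KCactus G 2 → Σ (Θ 3) Inside → IsThetaGraph G 3 B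
    theta⇒2 K (θ , inB) = isThetaGraph θ inB (Θ-maximal θ inB K)

    theta⇒3 : KCactus G 3 → Σ (Θ 3) Inside → IsThetaGraph G 3 B ⊎ IsThetaGraph G 4 B
    theta⇒3 K (θ , inB) with Θ-ear θ inB
    ... | inj₁ c = inj₁ (isThetaGraph θ inB c)
    ... | inj₂ (Q , QE) with spans? θ (foot Q) (head Q)
    ...   | yes s = let θ' , inB' = Θ-extend θ inB Q QE s in inj₂ (isThetaGraph θ' inB' (Θ-maximal θ' inB' K))
    ...   | no ns = ⊥-elim (family-bound (proj₂ (proj₂ (proj₂ (ear-family θ Q ns)))) K)

    module _ (K : KCactus G 4) (θ : Θ 3) (inB : Inside θ) (Q : EarOf (ΘV θ) (ΘE θ))
             (QE : ∀ {u w} → Edge (body Q) u w → T (E B u w)) (ns : ¬ Spans θ (foot Q) (head Q)) where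

      -- Four cycles pass through the edge given by `ear-family`; a further edge of `B` would
      -- produce a fifth.
      earTheta-full : ∀ {a z} → T (E B a z) → ΘE θ a z ⊎ Edge (body Q) a z
      earTheta-full {a} {z} e = decidable-stable (ΘE? θ a z ⊎-dec edge? (pairs (verts (body Q))) a z) λ ¬F →
        let _ , _ , g , F = ear-family θ Q ns in
        family-bound (family-grow B 2c F (λ P h → ¬F (P h)) (inB g) e) K

      isTheta3' : IsTheta3'Graph G B
      isTheta3' = T.theta , R.ear
        , (λ v → mk⇔ (λ v∈ → Sum.map T.V⇒ (∈-resp eq) (cover v∈))
                     [ (λ h → Θ-⊆V θ inB (T.V⇐ zero h)) , (λ i → path-⊆V (body Q) (foot≢head Q) QE (∈-resp (sym eq) i)) ]′)
        , (λ a b → mk⇔ (λ e → Sum.map T.E⇒ (edge-resp (cong pairs eq)) (earTheta-full e))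
                       [ (λ h → inB (T.E⇐ h)) , (λ f → QE (edge-resp (cong pairs (sym eq)) f)) ]′)
        where
        module T = ToTheta θ
        module R = ToEar θ Q ns
        eq = proj₂ R.emid-eq
        along : ∀ {u v} → Reach G (E B) u v → ΘV θ u ⊎ u ∈ᵖ body Q → ΘV θ v ⊎ v ∈ᵖ body Q
        along here       h = h
        along (step e r) h = along r (Sum.map (proj₂ ∘ ΘE-ends θ) (proj₂ ∘ edge-ends (body Q)) (earTheta-full e))
        cover : ∀ {v} → T (V B v) → ΘV θ v ⊎ v ∈ᵖ body Q
        cover v∈ = along (proj₁ 2c _ _ (proj₂ (src∈B θ inB)) v∈) (inj₁ (proj₁ (src∈B θ inB)))

    -- θ with the arc l removed still carries the ear, and misses the edges of arc l.
    no-chord : KCactus G 4 → (θ : Θ 4) → Inside θ → (Q : EarOf (ΘV θ) (ΘE θ)) →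
      (∀ {u w} → Edge (body Q) u w → T (E B u w)) → ¬ Spans θ (foot Q) (head Q) → ⊥
    no-chord K θ inB Q QE ns with avoid (proj₁ (foot∈ Q)) (proj₁ (head∈ Q))
    ... | l , l≢i , l≢j = [ (λ { (k , f) → arcs-edge-disjoint θ (punchInᵢ≢i l k) f e }) , (λ f → fresh Q f (l , e)) ]′
        (earTheta-full K θ' (λ { (k , f) → inB (_ , f) }) Q' QE ns (inB (l , e)))
      where
      θ' = removeArc θ l
      e = next-edge θ l
      keep : ∀ {v} → (h : ΘV θ v) → l ≢ proj₁ h → ΘV θ' v
      keep (i , v∈) l≢i = punchOut l≢i , subst (λ i → _ ∈ᵖ arc θ i) (sym (punchIn-punchOut l≢i)) v∈
      Q' : EarOf (ΘV θ') (ΘE θ')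
      Q' = record { foot≢head = foot≢head Q ; foot∈ = keep (foot∈ Q) l≢i ; head∈ = keep (head∈ Q) l≢j ; body = body Q
                  ; inner = λ { i (_ , v) → inner Q i (_ , v) } ; fresh = λ { f (_ , g) → fresh Q f (_ , g) } ; body-adj = body-adj Q }

    theta⇒4 : KCactus G 4 → Σ (Θ 3) Inside →
      IsTheta3'Graph G B ⊎ IsThetaGraph G 3 B ⊎ IsThetaGraph G 4 B ⊎ IsThetaGraph G 5 B
    theta⇒4 K (θ , inB) with Θ-ear θ inB
    ... | inj₁ c = inj₂ (inj₁ (isThetaGraph θ inB c))
    ... | inj₂ (Q , QE) with spans? θ (foot Q) (head Q)
    ...   | no ns = inj₁ (isTheta3' K θ inB Q QE ns)
    ...   | yes s with Θ-extend θ inB Q QE s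
    ...     | θ₄ , in₄ with Θ-ear θ₄ in₄
    ...       | inj₁ c = inj₂ (inj₂ (inj₁ (isThetaGraph θ₄ in₄ c)))
    ...       | inj₂ (R , RE) with spans? θ₄ (foot R) (head R)
    ...         | no ns  = ⊥-elim (no-chord K θ₄ in₄ R RE ns)
    ...         | yes s' = let θ₅ , in₅ = Θ-extend θ₄ in₄ R RE s' in
                  inj₂ (inj₂ (inj₂ (isThetaGraph θ₅ in₅ (Θ-maximal θ₅ in₅ K))))

  -- Blocks containing given cycles

  _⊑_ : Subgraph G → Subgraph G → Set
  _⊑_ = _⊆_ G

  ⊑-refl : ∀ {H} → H ⊑ H
  ⊑-refl = (λ _ h → h) , (λ _ _ h → h)

  ⊑-trans : ∀ {H H' H''} → H ⊑ H' → H' ⊑ H'' → H ⊑ H''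
  ⊑-trans (a , b) (c , d) = (λ v h → c v (a v h)) , (λ u w h → d u w (b u w h))

  reach-map : ∀ {E E'} → (∀ {u w} → T (E u w) → T (E' u w)) → ∀ {u v} → Reach G E u v → Reach G E' u v
  reach-map f here       = here
  reach-map f (step e r) = step (f e) (reach-map f r)

  trail-reach : ∀ {E x l y} → Trail x l y → (∀ {a b} → EdgeIn (pairs l) a b → T (E a b)) → Reach G E x y
  trail-reach stop   h = here
  trail-reach (go t) h = step (h (edge-resp (sym (pairs-trail t)) (inj₁ (here refl))))
    (trail-reach t (λ e → h (edge-resp (sym (pairs-trail t)) (edge-there e))))

  module _ (C : Cycle G) where
    cycleE? : ∀ u w → Dec (CycEdge G C u w)
    cycleE? = edge? (cpairs (cverts C))

    cycleGraph : Subgraph G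
    cycleGraph = subgraphOf (_∈? cverts C) cycleE? edge-sym (cycle-adj C) (proj₁ ∘ cycle-edge-ends C)

    -- Two vertices are joined by two arcs that meet only in their ends, so a deleted third vertex
    -- misses one of the arcs.
    cycleGraph-2c : TwoConnected cycleGraph
    cycleGraph-2c = (λ u v u∈ v∈ → conn (does⁻ (u ∈? cverts C) u∈) (does⁻ (v ∈? cverts C) v∈)) ,
      λ z (z∈ , cut) → cut λ u v u∈ v∈ →
        let u∈' , u≢z = delV⁻ {V cycleGraph} u∈ ; v∈' , v≢z = delV⁻ {V cycleGraph} v∈ in
        around (does⁻ (u ∈? cverts C) u∈') u≢z (does⁻ (v ∈? cverts C) v∈') v≢z
      where
      conn : ∀ {u v} → u ∈ cverts C → v ∈ cverts C → Reach G (E cycleGraph) u v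
      conn {u} {v} u∈ v∈ with u ≟ v
      ... | yes refl = here
      ... | no u≢v   = let p , _ , A = cycle-arcs C u∈ v∈ u≢v in
                       trail-reach (trail p) (λ e → does⁺ (cycleE? _ _) (Arcs.edgeˡ A e))
      avoiding : ∀ {u v z} (p : Path u v) → ¬ z ∈ᵖ p → (∀ {a b} → Edge p a b → CycEdge G C a b) →
        Reach G (delE G (E cycleGraph) z) u v
      avoiding p z∉ pE = trail-reach (trail p) (λ {a} {b} e → delE⁺ {E cycleGraph} (does⁺ (cycleE? a b) (pE e))
        (λ { refl → z∉ (proj₁ (edge-ends p e)) }) (λ { refl → z∉ (proj₂ (edge-ends p e)) }))
      around : ∀ {u v z} → u ∈ cverts C → u ≢ z → v ∈ cverts C → v ≢ z → Reach G (delE G (E cycleGraph) z) u v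
      around {u} {v} {z} u∈ u≢z v∈ v≢z with u ≟ v
      ... | yes refl = here
      ... | no u≢v with cycle-arcs C u∈ v∈ u≢v
      ...   | p , q , A with z ∈? verts p | z ∈? verts q
      ...     | no z∉  | _      = avoiding p z∉ (Arcs.edgeˡ A)
      ...     | yes _  | no z∉  = avoiding q z∉ (Arcs.edgeʳ A)
      ...     | yes zp | yes zq = ⊥-elim ([ u≢z ∘ sym , v≢z ∘ sym ]′ (Arcs.meet A zp zq))

  union : Subgraph G → Subgraph G → Subgraph G
  union H K = record
    { V = λ v → V H v ∨ V K v
    ; E = λ u w → E H u w ∨ E K u w
    ; E-sym = λ u w → cong₂ _∨_ (E-sym H u w) (E-sym K u w)
    ; E⊆adj = λ u w e → [ E⊆adj H u w , E⊆adj K u w ]′ (Equivalence.to T-∨ e)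
    ; E-ends = λ u w e → Equivalence.from T-∨ (Sum.map (E-ends H u w) (E-ends K u w) (Equivalence.to T-∨ e)) }

  reach-deleted : ∀ H → TwoConnected H → ∀ {x u v} → T (V H u) → u ≢ x → T (V H v) → v ≢ x →
    Reach G (delE G (E H) x) u v
  reach-deleted H 2c {x} {u} {v} u∈ u≢x v∈ v≢x with T? (V H x)
  ... | yes x∈ = reach-avoiding H 2c x∈ u∈ u≢x v∈ v≢x
  ... | no x∉  = reach-map (λ e → delE⁺ {E H} e (λ { refl → x∉ (E-ends H _ _ e) }) (λ { refl → x∉ (E-right H e) }))
                   (proj₁ 2c u v u∈ v∈)

  -- Of two common vertices at least one survives a deletion (`hub`), and every remaining vertex of
  -- either subgraph still reaches it.
  union-2c : ∀ H K → TwoConnected H → TwoConnected K → ∀ {u w} → u ≢ w →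
    T (V H u) → T (V K u) → T (V H w) → T (V K w) → TwoConnected (union H K)
  union-2c H K hc kc {u} {w} u≢w uH uK wH wK =
    (λ a b a∈ b∈ → reach-trans ([ (λ h → inH (proj₁ hc a u h uH)) , (λ h → inK (proj₁ kc a u h uK)) ]′ (Equivalence.to T-∨ a∈))
                               ([ (λ h → inH (proj₁ hc u b uH h)) , (λ h → inK (proj₁ kc u b uK h)) ]′ (Equivalence.to T-∨ b∈)))
    , λ z (_ , cut) → cut λ a b a∈ b∈ →
        let a∈' , a≢z = delV⁻ {V (union H K)} a∈ ; b∈' , b≢z = delV⁻ {V (union H K)} b∈
            s , s≢z , sH , sK = hub z
        in reach-trans
          ([ (λ h → inH' (reach-deleted H hc h a≢z sH s≢z)) , (λ h → inK' (reach-deleted K kc h a≢z sK s≢z)) ]′ (Equivalence.to T-∨ a∈'))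
          ([ (λ h → inH' (reach-deleted H hc sH s≢z h b≢z)) , (λ h → inK' (reach-deleted K kc sK s≢z h b≢z)) ]′ (Equivalence.to T-∨ b∈'))
    where
    EU = E (union H K)
    inH : ∀ {a b} → Reach G (E H) a b → Reach G EU a b
    inH = reach-map (λ e → Equivalence.from T-∨ (inj₁ e))
    inK : ∀ {a b} → Reach G (E K) a b → Reach G EU a b
    inK = reach-map (λ {a} {b} e → Equivalence.from (T-∨ {E H a b}) (inj₂ e))
    inH' : ∀ {z a b} → Reach G (delE G (E H) z) a b → Reach G (delE G EU z) a b
    inH' = reach-map (λ e → let h , p , q = delE⁻ {E H} e in delE⁺ {EU} (Equivalence.from T-∨ (inj₁ h)) p q)
    inK' : ∀ {z a b} → Reach G (delE G (E K) z) a b → Reach G (delE G EU z) a b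
    inK' = reach-map (λ {a} {b} e → let h , p , q = delE⁻ {E K} e in delE⁺ {EU} (Equivalence.from (T-∨ {E H a b}) (inj₂ h)) p q)
    hub : ∀ z → ∃ λ s → s ≢ z × T (V H s) × T (V K s)
    hub z with u ≟ z
    ... | no u≢z   = u , u≢z , uH , uK
    ... | yes refl = w , u≢w ∘ sym , wH , wK

  -- Vertices and edges are treated alike as positions, so that maximality becomes finitely many
  -- tests.
  Has : Subgraph G → Fin n ⊎ (Fin n × Fin n) → Set
  Has H (inj₁ v)       = T (V H v)
  Has H (inj₂ (u , w)) = T (E H u w)

  has-mono : ∀ {H K} → H ⊑ K → ∀ p → Has H p → Has K p
  has-mono (a , _) (inj₁ v)       = a v
  has-mono (_ , b) (inj₂ (u , w)) = b u w

  -- Greedily enlarge H, one vertex or edge of G at a time, whenever a 2-connected supergraph allows it.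
  saturate : ∀ ps H → TwoConnected H → ¬ ¬ (Σ (Subgraph G) λ K → H ⊑ K × TwoConnected K ×
    (∀ {p} → p ∈ ps → ∀ L → K ⊑ L → TwoConnected L → Has L p → Has K p))
  saturate []       H hc k = k (H , ⊑-refl {H} , hc , λ ())
  saturate (p ∷ ps) H hc k = ¬¬-excluded-middle {A = Σ (Subgraph G) λ L → H ⊑ L × TwoConnected L × Has L p} λ
    { (yes (H' , H⊑H' , hc' , has)) → saturate ps H' hc' λ { (K , H'⊑K , kc , sat) →
        k (K , ⊑-trans {H} {H'} {K} H⊑H' H'⊑K , kc , λ { (here refl) _ _ _ _ → has-mono {H'} {K} H'⊑K p has ; (there i) → sat i }) }
    -- If nothing containing `p` lies above `H`, nothing does above the larger `K`.
    ; (no none) → saturate ps H hc λ { (K , H⊑K , kc , sat) →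
        k (K , H⊑K , kc , λ { (here refl) L K⊑L lc h → ⊥-elim (none (L , ⊑-trans {H} {K} {L} H⊑K K⊑L , lc , h)) ; (there i) → sat i }) } }

  blockAround : ∀ H → TwoConnected H → ¬ ¬ (Σ (Subgraph G) λ B → IsBlock G B × H ⊑ B)
  blockAround H hc k = saturate positions H hc λ { (K , H⊑K , kc , sat) → k (K , (proj₁ kc , proj₂ kc ,
      λ L K⊑L lconn lcut → (λ v → sat (∈-++⁺ˡ (∈-map⁺ inj₁ (∈-allFin v))) L K⊑L (lconn , lcut))
                         , (λ u w → sat (∈-++⁺ʳ (map inj₁ (allFin n)) (∈-map⁺ inj₂ (∈-cartesianProduct⁺ (∈-allFin u) (∈-allFin w))))
                                        L K⊑L (lconn , lcut))) , H⊑K) }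
    where
    positions : List (Fin n ⊎ (Fin n × Fin n))
    positions = map inj₁ (allFin n) ++ map inj₂ (cartesianProduct (allFin n) (allFin n))

  -- Cycle and block share both ends of `uw`, so their union is 2-connected and by maximality lies
  -- in the block.
  cycle-⊆-block : ∀ B → IsBlock G B → ∀ {u w} → T (E B u w) → (C : Cycle G) → CycEdge G C u w →
    ∀ {a b} → CycEdge G C a b → T (E B a b)
  cycle-⊆-block B (Bconn , Bcut , Bmax) {u} {w} e C eC {a} {b} f =
    proj₂ (Bmax U ((λ v h → Equivalence.from T-∨ (inj₁ h)) , (λ u w h → Equivalence.from T-∨ (inj₁ h))) (proj₁ Uc) (proj₂ Uc))
      a b (Equivalence.from (T-∨ {E B a b}) (inj₂ (does⁺ (cycleE? C a b) f)))
    where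
    U = union B (cycleGraph C)
    ends = cycle-edge-ends C eC
    Uc = union-2c B (cycleGraph C) (Bconn , Bcut) (cycleGraph-2c C) (adj-irrefl (cycle-adj C eC))
      (E-ends B _ _ e) (does⁺ (u ∈? cverts C) (proj₁ ends)) (E-right B e) (does⁺ (w ∈? cverts C) (proj₂ ends))

  Bounded : ℕ → Subgraph G → Set
  Bounded k B = ∀ {u w} (cs : Fin (suc k) → Cycle G) → (∀ i → CycEdge G (cs i) u w) →
    (∀ i {a b} → CycEdge G (cs i) a b → T (E B a b)) → ∃[ i ] ∃[ j ] (i ≢ j × SameCycle G (cs i) (cs j))

  sameCycle? : ∀ C D → Dec (SameCycle G C D)
  sameCycle? C D = all? λ u → all? λ w → map′ (λ (f , g) → mk⇔ f g) (λ h → Equivalence.to h , Equivalence.from h)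
    ((cycleE? C u w →-dec cycleE? D u w) ×-dec (cycleE? D u w →-dec cycleE? C u w))

  -- The search for two coinciding cycles is decidable, so the doubly negated `blockAround` may be
  -- used. The block around one of the cycles contains the others, as they share `uw`.
  cactus-of-bounded : ∀ {k} → Connected G → (∀ B → IsBlock G B → Bounded k B) → KCactus G k
  cactus-of-bounded conn bounded = conn , λ u w _ cs through →
    decidable-stable (any? λ i → any? λ j → ¬? (i ≟ j) ×-dec sameCycle? (cs i) (cs j)) λ none →
      blockAround (cycleGraph (cs zero)) (cycleGraph-2c (cs zero)) λ { (B , block , _ , E⊆) →
        none (bounded B block cs through (λ i → cycle-⊆-block B block
          (E⊆ u w (does⁺ (cycleE? (cs zero) u w) (through zero))) (cs i) (through i))) }

  -- Even edge sets

  -- The sum over the field with two elements; on a row of an edge set it is the parity of the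
  -- degree.
  par : ∀ {m} → (Fin m → Bool) → Bool
  par {zero}  f = false
  par {suc m} f = f zero xor par (f ∘ suc)

  par-zero : ∀ {m} {f : Fin m → Bool} → (∀ z → f z ≡ false) → par f ≡ false
  par-zero {zero}      h = refl
  par-zero {suc m} {f} h rewrite h zero = par-zero (h ∘ suc)

  par-one : ∀ {m} {f : Fin m → Bool} a → (∀ z → z ≢ a → f z ≡ false) → par f ≡ f a
  par-one {suc m} {f} zero    h = trans (cong (f zero xor_) (par-zero (λ z → h (suc z) (λ ())))) (xor-identityʳ (f zero))
  par-one {suc m} {f} (suc a) h rewrite h zero (λ ()) = par-one a (λ z ne → h (suc z) (ne ∘ suc-injective))

  par-two : ∀ {m} {f : Fin m → Bool} {a b} → a ≢ b → (∀ z → z ≢ a → z ≢ b → f z ≡ false) → par f ≡ f a xor f b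
  par-two {suc m} {f} {zero}  {zero}  ne h = ⊥-elim (ne refl)
  par-two {suc m} {f} {zero}  {suc b} ne h =
    cong (f zero xor_) (par-one b (λ z z≢b → h (suc z) (λ ()) (z≢b ∘ suc-injective)))
  par-two {suc m} {f} {suc a} {zero}  ne h =
    trans (cong (f zero xor_) (par-one a (λ z z≢a → h (suc z) (z≢a ∘ suc-injective) (λ ())))) (xor-comm (f zero) (f (suc a)))
  par-two {suc m} {f} {suc a} {suc b} ne h rewrite h zero (λ ()) (λ ()) =
    par-two (ne ∘ cong suc) (λ z z≢a z≢b → h (suc z) (z≢a ∘ suc-injective) (z≢b ∘ suc-injective))

  par-xor : ∀ {m} (f g : Fin m → Bool) → par (λ z → f z xor g z) ≡ par f xor par g
  par-xor {zero}  f g = refl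
  par-xor {suc m} f g rewrite par-xor (f ∘ suc) (g ∘ suc) =
    interchange (f zero) (g zero) (par (f ∘ suc)) (par (g ∘ suc))
    where
    interchange : ∀ a b c d → (a xor b) xor (c xor d) ≡ (a xor c) xor (b xor d)
    interchange false false c     d = refl
    interchange false true  false d = refl
    interchange false true  true  d = refl
    interchange true  false false d = refl
    interchange true  false true  d = not-involutive d
    interchange true  true  false d = sym (not-involutive d)
    interchange true  true  true  d = refl

  xor-false : ∀ {a b} → a xor b ≡ false → a ≡ b
  xor-false {false} {false} _ = refl
  xor-false {true}  {true}  _ = refl

  false-of : ∀ {b} → ¬ T b → b ≡ false
  false-of {false} _ = refl
  false-of {true}  h = ⊥-elim (h tt)

  true-of : ∀ {b} → T b → b ≡ true
  true-of {true} _ = refl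

  -- A vector of the cycle space over the field with two elements, encoded as a symmetric matrix
  -- with even rows; containment in a graph is imposed separately as `supported`.
  record EvenSet (S : Fin n → Fin n → Bool) : Set where
    field
      symm : ∀ u w → S u w ≡ S w u
      even : ∀ v → par (S v) ≡ false

  χ : Cycle G → Fin n → Fin n → Bool
  χ C u w = does (cycleE? C u w)

  χ-even : ∀ C → EvenSet (χ C)
  χ-even C = record
    { symm = λ u w → T-ext (λ e → does⁺ (cycleE? C w u) (edge-sym (does⁻ (cycleE? C u w) e)))
                           (λ e → does⁺ (cycleE? C u w) (edge-sym (does⁻ (cycleE? C w u) e)))
    ; even = ev }
    where
    ev : ∀ v → par (χ C v) ≡ false
    ev v with v ∈? cverts C
    ... | no v∉  = par-zero (λ z → false-of (λ e → v∉ (proj₁ (cycle-edge-ends C (does⁻ (cycleE? C v z) e)))))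
    ... | yes v∈ = trans (par-two left≢right (λ z z≢l z≢r → false-of (λ e → [ z≢l , z≢r ]′ (only (does⁻ (cycleE? C v z) e)))))
                         (cong₂ _xor_ (true-of (does⁺ (cycleE? C v left) edgeˡ)) (true-of (does⁺ (cycleE? C v right) edgeʳ)))
      where open TwoNeighbours (cycle-neighbours C v∈)

  xor-even : ∀ {S R} → EvenSet S → EvenSet R → EvenSet (λ u w → S u w xor R u w)
  xor-even {S} {R} s r = record
    { symm = λ u w → cong₂ _xor_ (EvenSet.symm s u w) (EvenSet.symm r u w)
    ; even = λ v → trans (par-xor (S v) (R v)) (cong₂ _xor_ (EvenSet.even s v) (EvenSet.even r v)) }

  start-edge-unique : ∀ {x y z z' : Fin n} (p : Path x y) → Edge p x z → Edge p x z' → z ≡ z'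
  start-edge-unique (path stop ul) (inj₁ ())
  start-edge-unique (path stop ul) (inj₂ ())
  start-edge-unique {x = x} (path (go {w = w} {l = l} t) ul) e f = trans (to-w e) (sym (to-w f))
    where
    to-w : ∀ {z} → EdgeIn (pairs (x ∷ l)) x z → z ≡ w
    to-w e with edge-∷⁻ (edge-resp (pairs-trail t) e)
    ... | inj₁ (inj₁ (_ , eq))      = eq
    ... | inj₁ (inj₂ (refl , refl)) = refl
    ... | inj₂ e'                   = ⊥-elim (∉-of-unique ul (proj₁ (edge-∈ _ e')))

  module _ {S : Fin n → Fin n → Bool} (ev : EvenSet S) where
    open EvenSet ev

    private
      -- Evenness at an interior vertex of degree two equates the values on the two incident edges.
      constant : ∀ {x w l y} (t : Trail w l y) → Unique (x ∷ l) →
        (∀ {v z} → v ∈ l → v ≢ y → T (S v z) → EdgeIn (pairs (x ∷ l)) v z) →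
        ∀ {u u'} → EdgeIn (pairs (x ∷ l)) u u' → S u u' ≡ S x w
      constant stop ul h (inj₁ (here refl)) = refl
      constant stop ul h (inj₂ (here refl)) = symm _ _
      constant {x} {w} {l} {y} (go {w = w'} {l = l'} t) ul h {u} {u'} e with edge-∷⁻ e
      ... | inj₁ (inj₁ (refl , refl)) = refl
      ... | inj₁ (inj₂ (refl , refl)) = symm _ _
      ... | inj₂ e' = trans (constant t (unique-tail ul) h' e') (trans (sym w-even) (symm w x))
        where
        h' : ∀ {v z} → v ∈ l' → v ≢ y → T (S v z) → EdgeIn (pairs (w ∷ l')) v z
        h' v∈ v≢y s with edge-∷⁻ (h (there v∈) v≢y s)
        ... | inj₁ (inj₁ (refl , _)) = ⊥-elim (∉-of-unique ul (there v∈))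
        ... | inj₁ (inj₂ (refl , _)) = ⊥-elim (∉-of-unique (unique-tail ul) v∈)
        ... | inj₂ e''               = e''
        w-nbrs : ∀ z → T (S w z) → z ≡ x ⊎ z ≡ w'
        w-nbrs z s with edge-∷⁻ (h (here refl) (λ { refl → ∉-of-unique (unique-tail ul) (end∈ t) }) s)
        ... | inj₁ (inj₁ (w≡x , _)) = ⊥-elim (∉-of-unique ul (here (sym w≡x)))
        ... | inj₁ (inj₂ (_ , eq)) = inj₁ eq
        ... | inj₂ e'' = inj₂ (start-edge-unique (path (go t) (unique-tail ul)) e'' (edge-resp (sym (pairs-trail t)) (inj₁ (here refl))))
        w-even : S w x ≡ S w w'
        w-even = xor-false (trans (sym (par-two (λ { refl → ∉-of-unique ul (there (start∈ t)) })
          (λ z z≢x z≢w' → false-of (λ s → [ z≢x , z≢w' ]′ (w-nbrs z s))))) (even w))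

    path-constant : ∀ {x y} (p : Path x y) →
      (∀ {v z} → v ∈ᵖ p → v ≢ x → v ≢ y → T (S v z) → Edge p v z) →
      ∀ {u w u' w'} → Edge p u w → Edge p u' w' → S u w ≡ S u' w'
    path-constant (path stop   _)  h (inj₁ ())
    path-constant (path stop   _)  h (inj₂ ())
    path-constant (path (go t) ul) h e f = trans (constant t ul h' e) (sym (constant t ul h' f))
      where
      h' : ∀ {v z} → v ∈ _ → v ≢ _ → T (S v z) → _
      h' v∈ v≢y s = h (there v∈) (λ { refl → ∉-of-unique ul v∈ }) v≢y s

    module _ (θ : Θ t) (supported : ∀ {u w} → T (S u w) → ΘE θ u w) where

      arc-constant : ∀ i {u w u' w'} → Edge (arc θ i) u w → Edge (arc θ i) u' w' → S u w ≡ S u' w'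
      arc-constant i = path-constant (arc θ i) own
        where
        own : ∀ {v z} → v ∈ᵖ arc θ i → v ≢ src θ → v ≢ tgt θ → T (S v z) → Edge (arc θ i) v z
        own v∈ v≢s v≢t s with supported s
        ... | j , e with i ≟ j
        ...   | yes refl = e
        ...   | no i≢j   = ⊥-elim ([ v≢s , v≢t ]′ (meet θ i≢j v∈ (proj₁ (edge-ends (arc θ j) e))))

      -- At `src θ` only the first edges of the arcs can carry `S`, and evenness forbids exactly one
      -- of them.
      last-arc : ∀ i → (∀ j → j ≢ i → S (src θ) (next θ j) ≡ false) → S (src θ) (next θ i) ≡ false
      last-arc i others = trans (sym (par-one {f = S (src θ)} (next θ i) elsewhere)) (even (src θ))
        where
        elsewhere : ∀ z → z ≢ next θ i → S (src θ) z ≡ false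
        elsewhere z z≢ = false-of λ s → go' s (supported s)
          where
          go' : T (S (src θ) z) → ΘE θ (src θ) z → ⊥
          go' s (j , e) with start-edge-unique (arc θ j) e (next-edge θ j)
          ... | refl = subst T (others j (λ { refl → z≢ refl })) s

  -- Counting the cycles through an edge

  module _ (B : Subgraph G) where

    module ThetaBound (θ : Θ (suc t)) (B⊆ : ∀ {a b} → T (E B a b) → ΘE θ a b) {i₀ : Fin (suc t)} {u w : Fin n}
                      (uw : Edge (arc θ i₀) u w) where

      next-≢ : ∀ {i j} → i ≢ j → next θ i ≢ next θ j
      next-≢ {i} {j} i≢j eq = arcs-edge-disjoint θ i≢j (next-edge θ i)
        (subst (Edge (arc θ j) (src θ)) (sym eq) (next-edge θ j))

      module _ (C : Cycle G) (uwC : CycEdge G C u w) (C⊆ : ∀ {a b} → CycEdge G C a b → T (E B a b)) where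

        const : ∀ i {a b c d} → Edge (arc θ i) a b → Edge (arc θ i) c d → CycEdge G C a b → CycEdge G C c d
        const i {a} {b} {c} {d} e f h = does⁻ (cycleE? C c d)
          (subst T (arc-constant (χ-even C) θ (λ s → B⊆ (C⊆ (does⁻ (cycleE? C _ _) s))) i e f) (does⁺ (cycleE? C a b) h))

        leaves : CycEdge G C (src θ) (next θ i₀)
        leaves = const i₀ uw (next-edge θ i₀) uwC

        -- If `C` used no other arc at `src θ`, `last-arc` would empty arc `i₀`, which contains
        -- `uw`.
        partner : ∃ λ j → i₀ ≢ j × CycEdge G C (src θ) (next θ j)
        partner = decidable-stable (any? λ j → ¬? (i₀ ≟ j) ×-dec cycleE? C (src θ) (next θ j)) λ none →
          subst T (last-arc (χ-even C) θ (λ s → B⊆ (C⊆ (does⁻ (cycleE? C _ _) s))) i₀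
            (λ j j≢ → false-of (λ s → none (j , j≢ ∘ sym , does⁻ (cycleE? C _ _) s)))) (does⁺ (cycleE? C _ _) leaves)

        -- A cycle has only two edges at src θ.
        only-two : ∀ {j l} → i₀ ≢ j → CycEdge G C (src θ) (next θ j) → CycEdge G C (src θ) (next θ l) → l ≡ i₀ ⊎ l ≡ j
        only-two {j} {l} i₀≢j ej el with l ≟ i₀ | l ≟ j
        ... | yes h | _     = inj₁ h
        ... | no _  | yes h = inj₂ h
        ... | no l≢i₀ | no l≢j = ⊥-elim (clash (only leaves) (only ej) (only el))
          where
          open TwoNeighbours (cycle-neighbours C (proj₁ (cycle-edge-ends C leaves)))
          same : ∀ {a b c : Fin n} → a ≡ c → b ≡ c → a ≡ b
          same p q = trans p (sym q)
          clash : next θ i₀ ≡ left ⊎ next θ i₀ ≡ right → next θ j ≡ left ⊎ next θ j ≡ right → next θ l ≡ left ⊎ next θ l ≡ right → ⊥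
          clash (inj₁ p) (inj₁ q) _        = next-≢ i₀≢j (same p q)
          clash (inj₂ p) (inj₂ q) _        = next-≢ i₀≢j (same p q)
          clash (inj₁ p) (inj₂ q) (inj₁ r) = next-≢ l≢i₀ (same r p)
          clash (inj₁ p) (inj₂ q) (inj₂ r) = next-≢ l≢j (same r q)
          clash (inj₂ p) (inj₁ q) (inj₁ r) = next-≢ l≢j (same r q)
          clash (inj₂ p) (inj₁ q) (inj₂ r) = next-≢ l≢i₀ (same r p)

      -- Every edge of `C` lies on arc `i₀` or on the partner arc, and `D` contains both arcs
      -- entirely.
      included : ∀ C (eC : CycEdge G C u w) (C⊆ : ∀ {a b} → CycEdge G C a b → T (E B a b))
        D (eD : CycEdge G D u w) (D⊆ : ∀ {a b} → CycEdge G D a b → T (E B a b)) →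
        proj₁ (partner C eC C⊆) ≡ proj₁ (partner D eD D⊆) → ∀ {a b} → CycEdge G C a b → CycEdge G D a b
      included C eC C⊆ D eD D⊆ eq {a} {b} e with B⊆ (C⊆ e) | partner C eC C⊆ | partner D eD D⊆
      ... | l , f | j , i₀≢j , ej | j' , _ , ej' = const D eD D⊆ l (next-edge θ l) f
          ([ (λ { refl → leaves D eD D⊆ }) , (λ { refl → subst (λ j → CycEdge G D (src θ) (next θ j)) (sym eq) ej' }) ]′
            (only-two C eC C⊆ i₀≢j ej (const C eC C⊆ l f (next-edge θ l) e)))

    -- There are `t` possible partners, so among `t + 1` cycles two agree; `t ≤ k` provides that
    -- many.
    Θ-bounded : ∀ {k} (θ : Θ (suc t)) → t ≤ k → (∀ {a b} → T (E B a b) → ΘE θ a b) → Bounded k B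
    Θ-bounded {t = t} {k} θ t≤k B⊆ {u} {w} cs through inB = embed (pigeonhole ≤-refl code)
      where
      uw = B⊆ (inB zero (through zero))
      open ThetaBound θ B⊆ (proj₂ uw)
      ι : Fin (suc t) → Fin (suc k)
      ι i = inject≤ i (s≤s t≤k)
      mate : ∀ i → ∃ λ j → proj₁ uw ≢ j × CycEdge G (cs (ι i)) (src θ) (next θ j)
      mate i = partner (cs (ι i)) (through (ι i)) (inB (ι i))
      -- The partner differs from the arc of `uw`, so `punchOut` numbers it in `Fin t`.
      code : Fin (suc t) → Fin t
      code i = punchOut (proj₁ (proj₂ (mate i)))
      embed : (∃ λ i → ∃ λ j → i Fin.< j × code i ≡ code j) → ∃[ i ] ∃[ j ] (i ≢ j × SameCycle G (cs i) (cs j))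
      embed (i , j , i<j , eq) = ι i , ι j , (λ h → <⇒≢ i<j (inject≤-injective _ _ i j h)) , λ a b → mk⇔
        (included (cs (ι i)) (through (ι i)) (inB (ι i)) (cs (ι j)) (through (ι j)) (inB (ι j)) same)
        (included (cs (ι j)) (through (ι j)) (inB (ι j)) (cs (ι i)) (through (ι i)) (inB (ι i)) (sym same))
        where same = punchOut-injective (proj₁ (proj₂ (mate i))) (proj₁ (proj₂ (mate j))) eq

    -- Holds vacuously: a vertex of a cycle has two neighbours on it, while an end of a single edge
    -- has only one.
    edge-bounded : ∀ {k} → IsEdgeGraph G B → Bounded k B
    edge-bounded (x , y , _ , _ , E⇔) {u} {w} cs through inB = ⊥-elim (left≢right (only-one (at edgeˡ) (at edgeʳ)))
      where
      open TwoNeighbours (cycle-neighbours (cs zero) (proj₁ (cycle-edge-ends (cs zero) (through zero))))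
      at : ∀ {z} → CycEdge G (cs zero) u z → (u ≡ x × z ≡ y) ⊎ (u ≡ y × z ≡ x)
      at e = Equivalence.to (E⇔ _ _) (inB zero e)
      only-one : ∀ {z z'} → (u ≡ x × z ≡ y) ⊎ (u ≡ y × z ≡ x) → (u ≡ x × z' ≡ y) ⊎ (u ≡ y × z' ≡ x) → z ≡ z'
      only-one (inj₁ (_ , refl)) (inj₁ (_ , refl))       = refl
      only-one (inj₂ (_ , refl)) (inj₂ (_ , refl))       = refl
      only-one (inj₁ (refl , refl)) (inj₂ (refl , refl)) = refl
      only-one (inj₂ (refl , refl)) (inj₁ (refl , refl)) = refl

    cycle-bounded : ∀ {k} → IsCycleGraph G B → 1 ≤ k → Bounded k B
    cycle-bounded (C , _ , E⇔) 1≤k with cycle-hasEdge C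
    ... | _ , _ , e with adj-irrefl (cycle-adj C e)
    ...   | x≢y with cycle-arcs C (proj₁ (cycle-edge-ends C e)) (proj₂ (cycle-edge-ends C e)) x≢y
    ...     | _ , _ , A = Θ-bounded theta 1≤k (λ f → E⇐ (Equivalence.to (E⇔ _ _) f))
      where open ArcsTheta x≢y A

    theta-bounded : ∀ {k} → IsThetaGraph G (suc t) B → t ≤ k → Bounded k B
    theta-bounded (θ , _ , E⇔) t≤k = Θ-bounded (FromTheta.Θ-of θ) t≤k (λ e → Equivalence.to (E⇔ _ _) e)

  -- Even edge sets of a theta with an ear

  two-of-three : {i j l m : Fin 3} → i ≢ j → l ≢ i → l ≢ j → l ≢ m → m ≡ i ⊎ m ≡ j
  two-of-three {i} {j} {l} {m} i≢j l≢i l≢j l≢m with two (punchOut l≢i) (punchOut l≢j) (punchOut l≢m)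
    where
    two : (a b c : Fin 2) → a ≡ b ⊎ c ≡ a ⊎ c ≡ b
    two zero       zero       _          = inj₁ refl
    two (suc zero) (suc zero) _          = inj₁ refl
    two zero       (suc zero) zero       = inj₂ (inj₁ refl)
    two zero       (suc zero) (suc zero) = inj₂ (inj₂ refl)
    two (suc zero) zero       zero       = inj₂ (inj₂ refl)
    two (suc zero) zero       (suc zero) = inj₂ (inj₁ refl)
  ... | inj₁ h        = ⊥-elim (i≢j (punchOut-injective l≢i l≢j h))
  ... | inj₂ (inj₁ h) = inj₁ (punchOut-injective l≢m l≢i h)
  ... | inj₂ (inj₂ h) = inj₂ (punchOut-injective l≢m l≢j h)

  -- The even subsets of θ ∪ Q form a space of dimension three: one coordinate on the ear and two on θ.
  module _ (θ : Θ 3) (Q : EarOf (ΘV θ) (ΘE θ)) {S : Fin n → Fin n → Bool} (ev : EvenSet S)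
           (supported : ∀ {u w} → T (S u w) → ΘE θ u w ⊎ Edge (body Q) u w) where

    -- `S` is constant on the ear, so a zero there puts `S` inside `θ`. It is then constant on each
    -- arc, and `last-arc` carries the zeros of two arcs over to the third.
    vanish : ∀ {i j a₁ a₂ b₁ b₂ c₁ c₂} → i ≢ j →
      Edge (body Q) c₁ c₂ → S c₁ c₂ ≡ false → Edge (arc θ i) a₁ a₂ → S a₁ a₂ ≡ false → Edge (arc θ j) b₁ b₂ → S b₁ b₂ ≡ false →
      ∀ u w → S u w ≡ false
    vanish {i} {j} i≢j c Sc a Sa b Sb u w = false-of λ s → kill s (on-θ s)
      where
      own : ∀ {v z} → v ∈ᵖ body Q → v ≢ foot Q → v ≢ head Q → T (S v z) → Edge (body Q) v z
      own v∈ v≢f v≢h s with supported s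
      ... | inj₁ e = ⊥-elim ([ v≢f , v≢h ]′ (inner Q v∈ (proj₁ (ΘE-ends θ e))))
      ... | inj₂ e = e
      on-θ : ∀ {u w} → T (S u w) → ΘE θ u w
      on-θ s with supported s
      ... | inj₁ e = e
      ... | inj₂ e = ⊥-elim (subst T (trans (path-constant ev (body Q) own e c) Sc) s)
      const = arc-constant ev θ on-θ
      at-i : S (src θ) (next θ i) ≡ false
      at-i = trans (const i (next-edge θ i) a) Sa
      at-j : S (src θ) (next θ j) ≡ false
      at-j = trans (const j (next-edge θ j) b) Sb
      at : ∀ l → S (src θ) (next θ l) ≡ false
      at l with l ≟ i | l ≟ j
      ... | yes refl | _        = at-i
      ... | no _     | yes refl = at-j
      ... | no l≢i   | no l≢j   = last-arc ev θ on-θ l λ m m≢l →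
        [ (λ { refl → at-i }) , (λ { refl → at-j }) ]′ (two-of-three i≢j l≢i l≢j (m≢l ∘ sym))
      kill : ∀ {u w} → T (S u w) → ΘE θ u w → ⊥
      kill s (l , e) = subst T (trans (const l e (next-edge θ l)) (at l)) s

  bit : Bool → Fin 2
  bit false = zero
  bit true  = suc zero

  bit-injective : ∀ {a b} → bit a ≡ bit b → a ≡ b
  bit-injective {false} {false} _ = refl
  bit-injective {true}  {true}  _ = refl

  module _ (B : Subgraph G) (θ : Θ 3) (Q : EarOf (ΘV θ) (ΘE θ))
           (B⊆ : ∀ {a b} → T (E B a b) → ΘE θ a b ⊎ Edge (body Q) a b) where

    -- The sum of two of the cycles is even and vanishes on `uw`, which settles one of the three
    -- coordinates. The other two give four codes for five cycles, so some sum vanishes everywhere.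
    earTheta-bounded : Bounded 4 B
    earTheta-bounded {u} {w} cs through inB = choose (B⊆ (inB zero (through zero)))
      where
      Result = ∃[ i ] ∃[ j ] (i ≢ j × SameCycle G (cs i) (cs j))
      zeroes : Fin 5 → Fin 5 → Fin n → Fin n → Set
      zeroes i j a b = χ (cs i) a b xor χ (cs j) a b ≡ false
      agree : ∀ {b c} → b ≡ c → b xor c ≡ false
      agree {b} refl = xor-same b
      at-uw : ∀ i j → zeroes i j u w
      at-uw i j = agree (trans (true-of (does⁺ (cycleE? (cs i) u w) (through i)))
                          (sym (true-of (does⁺ (cycleE? (cs j) u w) (through j)))))
      supported : ∀ i j {a b} → T (χ (cs i) a b xor χ (cs j) a b) → ΘE θ a b ⊎ Edge (body Q) a b
      supported i j {a} {b} s = B⊆ ([ (λ h → inB i (does⁻ (cycleE? (cs i) a b) h)) , (λ h → inB j (does⁻ (cycleE? (cs j) a b) h)) ]′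
        (one (χ (cs i) a b) (χ (cs j) a b) s))
        where
        one : ∀ p q → T (p xor q) → T p ⊎ T q
        one true  _ _ = inj₁ tt
        one false _ h = inj₂ h
      module _ {a b c d : Fin n}
               (full : ∀ i j → zeroes i j u w → zeroes i j a b → zeroes i j c d → ∀ x y → zeroes i j x y) where
        code : Fin 5 → Fin 4
        code i = combine (bit (χ (cs i) a b)) (bit (χ (cs i) c d))
        conclude : Result
        conclude with pigeonhole ≤-refl code
        ... | i , j , i<j , eq with combine-injective (bit (χ (cs i) a b)) _ _ _ eq
        ...   | p , q = i , j , <⇒≢ i<j , λ x y →
          let h = xor-false (full i j (at-uw i j) (agree (bit-injective p)) (agree (bit-injective q)) x y) in mk⇔
            (λ e → does⁻ (cycleE? (cs j) x y) (subst T h (does⁺ (cycleE? (cs i) x y) e)))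
            (λ e → does⁻ (cycleE? (cs i) x y) (subst T (sym h) (does⁺ (cycleE? (cs j) x y) e)))
      all-zero : ∀ i j {k l a₁ a₂ b₁ b₂ c₁ c₂} → k ≢ l →
        Edge (body Q) c₁ c₂ → zeroes i j c₁ c₂ → Edge (arc θ k) a₁ a₂ → zeroes i j a₁ a₂ → Edge (arc θ l) b₁ b₂ → zeroes i j b₁ b₂ →
        ∀ x y → zeroes i j x y
      all-zero i j = vanish θ Q (xor-even (χ-even (cs i)) (χ-even (cs j))) (supported i j)
      -- If `uw` is on the ear, the free coordinates are two arcs; otherwise they are the ear and
      -- one further arc.
      choose : ΘE θ u w ⊎ Edge (body Q) u w → Result
      choose (inj₂ e) = conclude λ i j z z₁ z₂ →
        all-zero i j (λ ()) e z (next-edge θ zero) z₁ (next-edge θ (suc zero)) z₂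
      choose (inj₁ (k , e)) with avoid k k
      ... | l , l≢k , _ = conclude λ i j z z₁ z₂ →
        all-zero i j (l≢k ∘ sym) (proj₂ (firstEdge (body Q) (foot≢head Q))) z₁ e z (next-edge θ l) z₂

  theta3'-bounded : ∀ B → IsTheta3'Graph G B → Bounded 4 B
  theta3'-bounded B (θ , Q , _ , E⇔) = earTheta-bounded B F.Θ-of ear (λ e → Equivalence.to (E⇔ _ _) e)
    where
    module F = FromTheta θ
    ear : EarOf (ΘV F.Θ-of) (ΘE F.Θ-of)
    ear = record
      { foot≢head = ea≢eb Q ; foot∈ = F.V⇐ zero (eaIn Q) ; head∈ = F.V⇐ zero (ebIn Q)
      ; body = path (trail-snoc (ea Q) (emid Q)) (proj₁ (epath Q))
      ; inner = λ i v → inn (∈-snoc (emid Q) i) v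
      ; fresh = λ {u} {w} e f → eedges Q u w e f
      ; body-adj = adj-of-all (proj₂ (epath Q)) }
      where
      inn : ∀ {v} → v ≡ ea Q ⊎ v ≡ eb Q ⊎ v ∈ emid Q → ΘV F.Θ-of v → v ≡ ea Q ⊎ v ≡ eb Q
      inn (inj₁ h)        _ = inj₁ h
      inn (inj₂ (inj₁ h)) _ = inj₂ h
      inn (inj₂ (inj₂ h)) v = ⊥-elim (einner Q _ h (F.V⇒ v))

-- The three equivalences

theorem2 : (G : Graph) → 2 ≤ Graph.n G → Connected G →
    (KCactus G 2 ⇔ (∀ B → IsBlock G B →
    IsEdgeGraph G B ⊎ IsCycleGraph G B ⊎ IsThetaGraph G 3 B))
    × (KCactus G 3 ⇔ (∀ B → IsBlock G B →
    IsEdgeGraph G B ⊎ IsCycleGraph G B ⊎ IsThetaGraph G 3 B ⊎ IsThetaGraph G 4 B))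
    × (KCactus G 4 ⇔ (∀ B → IsBlock G B →
    IsEdgeGraph G B ⊎ IsCycleGraph G B ⊎ IsTheta3'Graph G B
    ⊎ IsThetaGraph G 3 B ⊎ IsThetaGraph G 4 B ⊎ IsThetaGraph G 5 B))
theorem2 G 2≤n conn =
    mk⇔ (λ K B block → classify B block (theta⇒2 G B (twoConn B block) K))
        (λ shape → cactus-of-bounded G conn (λ B block → bounded₂ B (shape B block)))
  , mk⇔ (λ K B block → classify B block (theta⇒3 G B (twoConn B block) K))
        (λ shape → cactus-of-bounded G conn (λ B block → bounded₃ B (shape B block)))
  , mk⇔ (λ K B block → classify B block (theta⇒4 G B (twoConn B block) K))
        (λ shape → cactus-of-bounded G conn (λ B block → bounded₄ B (shape B block)))
  where
  twoConn : ∀ B → IsBlock G B → TwoConnected G B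
  twoConn B (Bc , Bcut , _) = Bc , Bcut

  classify : ∀ B (block : IsBlock G B) {X : Set} → (Σ (Θ G 3) (Inside G B (twoConn B block)) → X) →
    IsEdgeGraph G B ⊎ IsCycleGraph G B ⊎ X
  classify B block f = let _ , _ , e = block-edge G 2≤n conn B block in
    Sum.map₂ (Sum.map₂ f) (edge-cycle-or-theta G B (twoConn B block) e)

  bounded₂ : ∀ B → IsEdgeGraph G B ⊎ IsCycleGraph G B ⊎ IsThetaGraph G 3 B → Bounded G 2 B
  bounded₂ B (inj₁ h)        = edge-bounded G B h
  bounded₂ B (inj₂ (inj₁ h)) = cycle-bounded G B h (s≤s z≤n)
  bounded₂ B (inj₂ (inj₂ h)) = theta-bounded G B h ≤-refl

  bounded₃ : ∀ B → IsEdgeGraph G B ⊎ IsCycleGraph G B ⊎ IsThetaGraph G 3 B ⊎ IsThetaGraph G 4 B → Bounded G 3 B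
  bounded₃ B (inj₁ h)               = edge-bounded G B h
  bounded₃ B (inj₂ (inj₁ h))        = cycle-bounded G B h (s≤s z≤n)
  bounded₃ B (inj₂ (inj₂ (inj₁ h))) = theta-bounded G B h (s≤s (s≤s z≤n))
  bounded₃ B (inj₂ (inj₂ (inj₂ h))) = theta-bounded G B h ≤-refl

  bounded₄ : ∀ B → IsEdgeGraph G B ⊎ IsCycleGraph G B ⊎ IsTheta3'Graph G B
    ⊎ IsThetaGraph G 3 B ⊎ IsThetaGraph G 4 B ⊎ IsThetaGraph G 5 B → Bounded G 4 B
  bounded₄ B (inj₁ h)                             = edge-bounded G B h
  bounded₄ B (inj₂ (inj₁ h))                      = cycle-bounded G B h (s≤s z≤n)
  bounded₄ B (inj₂ (inj₂ (inj₁ h)))               = theta3'-bounded G B h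
  bounded₄ B (inj₂ (inj₂ (inj₂ (inj₁ h))))        = theta-bounded G B h (s≤s (s≤s z≤n))
  bounded₄ B (inj₂ (inj₂ (inj₂ (inj₂ (inj₁ h))))) = theta-bounded G B h (s≤s (s≤s (s≤s z≤n)))
  bounded₄ B (inj₂ (inj₂ (inj₂ (inj₂ (inj₂ h))))) = theta-bounded G B h ≤-refl
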